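{- Let $\lambda\in\mathbb{Z}$ and suppose $f\in\mathbb{K}(x)$ is $\lambda$-Mahler summable. (1) If $\infty\in\mathrm{supp}(f)$ and either $\lambda=0$ or $f_\infty\notin\mathbb{K}$, then $\mathrm{disp}(f,\infty)>0$. (2) If $\lambda\leq0$ then $\mathrm{disp}(f,\tau)>0$ for every Mahler tree $\tau\in\mathrm{supp}(f)$. (3) If $\lambda\geq1$ and $\tau\in\mathrm{supp}(f)$ is a Mahler tree such that either $\tau\in\mathcal{T}_0$ or $\mathrm{ord}(f,\tau)\neq\lambda$, then $\mathrm{disp}(f,\tau)>0$.
   Context: $\mathbb{K}$ is an algebraically closed field of characteristic zero, $p\ge2$ a fixed integer, $\sigma(f(x))=f(x^p)$, $\Delta_\lambda:=p^\lambda\sigma-\mathrm{id}$; $f$ is $\lambda$-Mahler summable if $f=\Delta_\lambda(g)$ for some $g\in\mathbb{K}(x)$. Every $f\in\mathbb{K}(x)$ decomposes uniquely as $f=f_\infty+f_{\mathcal{T}}$, $f_\infty\in\mathbb{K}[x,x^{ -1}]$, $f_{\mathcal{T}}=a/b$ with $a=0$ or $\deg a<\deg b$, $\gcd(a,b)=1=\gcd(x,b)$. Mahler trees are the classes of $\mathbb{K}^\times$ under $\alpha\sim\gamma\iff\alpha^{p^r}=\gamma^{p^s}$ ($r,s\ge0$). For a tree $\tau$, $\mathcal{C}(\tau)$ is the set of elements of $\tau$ that are roots of unity of order coprime to $p$; $\mathcal{T}_0$ is the set of trees with $\mathcal{C}(\tau)=\emptyset$. Mahler support: $\infty\in\mathrm{supp}(f)$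 iff $f_\infty\ne0$; a tree $\tau\in\mathrm{supp}(f)$ iff $\tau$ contains a pole of $f$; $\mathrm{sing}(f,\tau)$ is the set of poles of $f$ in $\tau$ and $\mathrm{ord}(f,\tau):=\max(\{0\}\cup\{\mathrm{ord}_\alpha f:\alpha\in\mathrm{sing}(f,\tau)\})$. Mahler dispersion, for $\tau\in\mathrm{supp}(f)$: if $\tau$ is a tree, $\mathrm{disp}(f,\tau)$ is the largest $d\ge0$ for which some $\alpha\in\mathrm{sing}(f,\tau)$ has $\alpha^{p^d}\in\mathrm{sing}(f,\tau)$, and $\infty$ if there is no largest such $d$. For $\tau=\infty$, writing $f_\infty=\sum_ic_ix^i$: if $f_\infty=c_0\ne0$ then $\mathrm{disp}(f,\infty)=0$; otherwise it is the largest $d\ge0$ such that some $i\ne0$ has $c_i\ne0$ and $c_{ip^d}\ne0$. -}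

module Defs where

open import Level using (Level; _⊔_; suc)
open import Algebra.Bundles using (CommutativeRing)
open import Data.Nat as ℕ using (ℕ; zero; _∸_; _<_; _≤_)
open import Data.Nat.Coprimality using (Coprime)
open import Data.Integer as ℤ using (ℤ; +_; -[1+_])
open import Data.List using (List; []; _∷_; _++_; replicate; map)
open import Data.Maybe using (Maybe; just; nothing)
open import Data.Product using (Σ; ∃; _×_; _,_)
open import Data.Sum using (_⊎_)
open import Data.Unit using (⊤)
open import Relation.Nullary using (¬_)
open import Relation.Binary.PropositionalEquality using (_≡_; _≢_)

-- An algebraically closed field of characteristic zero.
-- Built on a commutative ring (setoid equality _≈_); polynomials are
-- coefficient lists [c₀, c₁, …, cₙ] (lowest degree first).

module RingOps {c ℓ : Level} (R : CommutativeRing c ℓ) where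
  open CommutativeRing R

  fromℕ : ℕ → Carrier
  fromℕ zero      = 0#
  fromℕ (ℕ.suc n) = 1# + fromℕ n

  _^_ : Carrier → ℕ → Carrier
  x ^ zero    = 1#
  x ^ ℕ.suc n = x * (x ^ n)

  evalP : List Carrier → Carrier → Carrier
  evalP []       _ = 0#
  evalP (a ∷ as) x = a + x * evalP as x

record ACField (c ℓ : Level) : Set (Level.suc (c ⊔ ℓ)) where
  field
    cring : CommutativeRing c ℓ
  open CommutativeRing cring public
  open RingOps cring public
  field
    1≉0      : ¬ (1# ≈ 0#)
    _⁻¹      : Carrier → Carrier
    inverse  : ∀ x → ¬ (x ≈ 0#) → x * (x ⁻¹) ≈ 1#
    char0    : ∀ n → ¬ (fromℕ (ℕ.suc n) ≈ 0#)
    algClosed : ∀ (c₀ : Carrier) (cs : List Carrier) (cₙ : Carrier) →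
                ¬ (cₙ ≈ 0#) → ∃ λ α → evalP (c₀ ∷ cs ++ cₙ ∷ []) α ≈ 0#

module _ {c ℓ : Level} (K : ACField c ℓ) where
  open ACField K

  Poly : Set c
  Poly = List Carrier

  coeff : Poly → ℕ → Carrier
  coeff []       _         = 0#
  coeff (a ∷ as) zero      = a
  coeff (a ∷ as) (ℕ.suc n) = coeff as n

  _≈ₚ_ : Poly → Poly → Set ℓ
  P ≈ₚ Q = ∀ n → coeff P n ≈ coeff Q n

  NonZeroP : Poly → Set ℓ
  NonZeroP P = ∃ λ n → coeff P n ≉ 0#

  _+ₚ_ : Poly → Poly → Poly
  []       +ₚ Q        = Q
  (a ∷ P)  +ₚ []       = a ∷ P
  (a ∷ P)  +ₚ (b ∷ Q)  = (a + b) ∷ (P +ₚ Q)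

  _·ₚ_ : Carrier → Poly → Poly
  a ·ₚ P = map (a *_) P

  -ₚ_ : Poly → Poly
  -ₚ P = map (-_) P

  _*ₚ_ : Poly → Poly → Poly
  []      *ₚ Q = []
  (a ∷ P) *ₚ Q = (a ·ₚ Q) +ₚ (0# ∷ (P *ₚ Q))

  xpow : ℕ → Poly
  xpow n = replicate n 0# ++ 1# ∷ []

  linPow : Carrier → ℕ → Poly
  linPow α zero      = 1# ∷ []
  linPow α (ℕ.suc m) = ((- α) ∷ 1# ∷ []) *ₚ linPow α m

  _∣ₚ_ : Poly → Poly → Set (c ⊔ ℓ)
  D ∣ₚ P = ∃ λ Q → (Q *ₚ D) ≈ₚ P

  Mult : Poly → Carrier → ℕ → Set (c ⊔ ℓ)
  Mult P α m = (linPow α m ∣ₚ P) × ¬ (linPow α (ℕ.suc m) ∣ₚ P)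

  record RatFun : Set (c ⊔ ℓ) where
    constructor _/_⟨_⟩
    field
      num   : Poly
      den   : Poly
      denNZ : NonZeroP den
  open RatFun public

  _≃_/_ : RatFun → Poly → Poly → Set ℓ
  f ≃ a / b = (num f *ₚ b) ≈ₚ (a *ₚ den f)

  module Mahler (p : ℕ) where

    -- σ : P(x) ↦ P(x^p)  on coefficient lists
    spread : Poly → Poly
    spread []      = []
    spread (a ∷ P) = a ∷ (replicate (p ∸ 1) 0# ++ spread P)

    pK : Carrier
    pK = fromℕ p

    -- p ^ λ in K, for λ ∈ ℤ  (p⁻¹ exists since char K = 0 and p ≥ 1)
    pPow : ℤ → Carrier
    pPow (+ n)      = pK ^ n
    pPow -[1+ n ]   = (pK ⁻¹) ^ ℕ.suc n

    -- f = Δ_λ(g) = p^λ σ(g) - g  for some g = gn / gd ∈ K(x)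
    MahlerSummable : ℤ → RatFun → Set (c ⊔ ℓ)
    MahlerSummable l f =
      ∃ λ (g : RatFun) →
        f ≃ ((pPow l ·ₚ (spread (num g) *ₚ den g)) +ₚ (-ₚ (num g *ₚ spread (den g))))
          / (spread (den g) *ₚ den g)

    -- Laurent polynomials: (n , P) stands for x^{-n} P(x)
    Laurent : Set c
    Laurent = ℕ × Poly

    lcoeff : Laurent → ℤ → Carrier
    lcoeff (n , P) i with i ℤ.+ + n
    ... | + k      = coeff P k
    ... | -[1+ _ ] = 0#

    -- f = f_∞ + a/b with (a = 0 or deg a < deg b) and gcd(x, b) = 1
    -- "a = 0 or deg a < deg b":  a has no coefficient in degrees ≥ deg b
    ProperFrac : Poly → Poly → Set ℓ
    ProperFrac a b = ∃ λ d → coeff b d ≉ 0# × (∀ j → d < j → coeff b j ≈ 0#)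
                             × (∀ j → d ≤ j → coeff a j ≈ 0#)

    IsInftyPart : RatFun → Laurent → Set (c ⊔ ℓ)
    IsInftyPart f (n , P) =
      ∃ λ a → ∃ λ b → coeff b 0 ≉ 0# × ProperFrac a b ×
        f ≃ ((P *ₚ b) +ₚ (a *ₚ xpow n)) / (xpow n *ₚ b)

    -- ∞ ∈ supp f  iff  f_∞ ≠ 0
    LNonZero : Laurent → Set ℓ
    LNonZero L = ∃ λ i → lcoeff L i ≉ 0#

    LConst : Laurent → Set ℓ
    LConst L = ∀ i → i ≢ + 0 → lcoeff L i ≈ 0#

    -- dispersion at ∞ (nothing = ∞)
    DispWitnessInf : Laurent → ℕ → Set ℓ
    DispWitnessInf L d = ∃ λ i → i ≢ + 0 × lcoeff L i ≉ 0#
                                 × lcoeff L (i ℤ.* + (p ℕ.^ d)) ≉ 0#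

    DispGen : {a : Level} → (ℕ → Set a) → Maybe ℕ → Set a
    DispGen W (just d) = W d × (∀ d′ → d < d′ → ¬ W d′)
    DispGen W nothing  = ∀ d → ∃ λ d′ → d ≤ d′ × W d′

    DispInf : Laurent → Maybe ℕ → Set ℓ
    DispInf L D = (LConst L × lcoeff L (+ 0) ≉ 0# × D ≡ just 0)
                ⊎ (¬ (LConst L × lcoeff L (+ 0) ≉ 0#) × DispGen (DispWitnessInf L) D)

    Positive : Maybe ℕ → Set
    Positive (just d) = 0 < d
    Positive nothing  = ⊤

    -- Mahler trees, represented by any element β ≠ 0 of the tree
    InTree : Carrier → Carrier → Set ℓ
    InTree β α = α ≉ 0# × ∃ λ r → ∃ λ s → (α ^ (p ℕ.^ r)) ≈ (β ^ (p ℕ.^ s))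

    PoleOfOrder : RatFun → Carrier → ℕ → Set (c ⊔ ℓ)
    PoleOfOrder f α k = 0 < k × ∃ λ ma → ∃ λ mb →
      Mult (num f) α ma × Mult (den f) α mb × mb ≡ k ℕ.+ ma

    IsPole : RatFun → Carrier → Set (c ⊔ ℓ)
    IsPole f α = ∃ λ k → PoleOfOrder f α k

    Sing : RatFun → Carrier → Carrier → Set (c ⊔ ℓ)
    Sing f β α = InTree β α × IsPole f α

    TreeInSupp : RatFun → Carrier → Set (c ⊔ ℓ)
    TreeInSupp f β = ∃ λ α → Sing f β α

    OrdIs : RatFun → Carrier → ℕ → Set (c ⊔ ℓ)
    OrdIs f β n = (∀ α k → InTree β α → PoleOfOrder f α k → k ≤ n)
                × (n ≡ 0 ⊎ ∃ λ α → InTree β α × PoleOfOrder f α n)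

    RootOfUnityCoprime : Carrier → Set ℓ
    RootOfUnityCoprime α = ∃ λ n → 0 < n × (α ^ n) ≈ 1#
      × (∀ m → 0 < m → m < n → ¬ ((α ^ m) ≈ 1#)) × Coprime n p

    InT0 : Carrier → Set (c ⊔ ℓ)
    InT0 β = ∀ α → InTree β α → ¬ RootOfUnityCoprime α

    -- dispersion at a tree (nothing = ∞)
    DispWitnessTree : RatFun → Carrier → ℕ → Set (c ⊔ ℓ)
    DispWitnessTree f β d = ∃ λ α → Sing f β α × Sing f β (α ^ (p ℕ.^ d))

    DispTree : RatFun → Carrier → Maybe ℕ → Set (c ⊔ ℓ)
    DispTree f β D = DispGen (DispWitnessTree f β) D

{-# OPTIONS --safe #-}

-- Write f = p^λ σ(g) - g.
--
-- At infinity, expanding g at x = ∞ and at x = 0 gives c_i = p^λ φ_{i/p} - φ_i with φ finitely supported.  If the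
-- dispersion were 0, some orbit i, ip, ip², … would carry exactly one nonzero c, say c_i: reading the recursion downwards
-- from far out gives φ_i = 0, so φ_{i/p} ≠ 0, and the recursion then forces φ_{i/p²} ≠ 0, φ_{i/p³} ≠ 0, … for ever.
--
-- In a tree, let δ be a pole of f of order n and suppose the dispersion is 0.  If g had a pole at δ, it would have one
-- at every iterated p-th root of δ, since f is regular there: infinitely many.  So g has a pole of order n at δ^p, and
-- then at all δ^(p^k) with k ≥ 1, as f is regular there too.  Only finitely many of these are distinct, so some ζ among
-- them is periodic under α ↦ α^p, hence a root of unity of order coprime to p.  Comparing leading coefficients of
-- p^λ σ(g) and g once around the cycle of ζ gives p^(λ e) = p^(n e), that is n = λ.
--
-- Equality in the field is not decidable.  As positivity of the dispersion is, everything is proved under ¬ ¬.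

module Submission where

open import Defs
open import Algebra.Bundles using (CommutativeRing)
import Algebra.Solver.Ring.NaturalCoefficients.Default as NaturalSolver
open import Data.Empty using (⊥; ⊥-elim)
open import Data.Integer as ℤ using (ℤ; +_; -[1+_]) renaming (_≤_ to _≤ℤ_)
import Data.Integer.Properties as ℤ
open import Data.List using (List; []; _∷_; _++_; length; replicate)
open import Data.Maybe using (Maybe; just; nothing)
open import Data.Nat as ℕ using (ℕ; zero; suc; _≤_; s≤s; z≤n)
open import Data.Nat.DivMod using (_%_; _/_; m≡m%n+[m/n]*n; m%n<n)
open import Data.Nat.Divisibility
  using (_∣_; _∣?_; divides; ∣m∣n⇒∣m+n; ∣m+n∣m⇒∣n; ∣-refl; ∣-trans; _∣0; m∣m*n; ∣1⇒≡1; m%n≡0⇒n∣m)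
open import Data.Nat.Induction using (<-rec)
import Data.Nat.Properties as ℕ
import Data.Nat.Tactic.RingSolver as ℕ
open import Data.Product using (_,_; _×_; ∃; proj₁; proj₂)
open import Data.Sum using (_⊎_; inj₁; inj₂)
open import Data.Unit using (tt)
open import Level using (Level; _⊔_)
open import Relation.Binary using (IsEquivalence; Setoid; tri<; tri≈; tri>)
import Relation.Binary.PropositionalEquality as ≡
open ≡ using (_≡_; _≢_)
import Relation.Binary.Reasoning.Setoid as SetoidReasoning
open import Relation.Nullary using (¬_; Dec; yes; no)
open import Relation.Nullary.Decidable using (¬¬-excluded-middle)

-- Since equality is undecidable, fractions are never reduced. A pole of order n at α is carried as
-- a pair of multiplicities with b = n + a, and with κ = p^λ the equation f + g - κσ(g) = 0 is used
-- with its denominators cleared: three polynomials whose sum is zero. At a point α ≠ 0 the lowest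
-- of the three multiplicities has to occur at least twice, and all transfer of poles between α and
-- α^p comes from this comparison. It loses nothing, because x^p - α^p has only a simple root at α
-- in characteristic zero. Its slope p α^(p-1) enters the leading coefficients; rewritten as p γ / α
-- with γ = α^p, it leaves a factor p at each step while the points telescope to 1 around a cycle.
-- This is the origin of the power p^(n e). At infinity and at 0 the finitely supported φ is
-- obtained by dividing the numerator of g by its denominator in descending and in ascending powers.
-- The constant coefficient lies outside the orbit argument: for λ = 0 it vanishes because σ fixes
-- the constant term. Only the value 0 of the dispersion has to be excluded, and its maximality
-- supplies the absence of witnesses for every d > 0.

-- Coefficient lists as a commutative ring, and their evaluation

module Polynomials {c ℓ : Level} (K : ACField c ℓ) where
  open ACField K
  module ≈-Reasoning = SetoidReasoning setoid
  open import Algebra.Properties.Ring ring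
  open NaturalSolver commutativeSemiring using (solve; _:=_; _:+_; _:*_; con)

  infixl 6 _⊕_
  infixl 7 _⊛_
  infixr 7 _⊙_
  infix 4 _≋_

  _⊕_ _⊛_ : Poly K → Poly K → Poly K
  _⊕_ = Defs._+ₚ_ K
  _⊛_ = Defs._*ₚ_ K

  _⊙_ : Carrier → Poly K → Poly K
  _⊙_ = Defs._·ₚ_ K

  ⊖_ : Poly K → Poly K
  ⊖_ = Defs.-ₚ_ K

  infixl 21 _[_]
  _[_] : Poly K → ℕ → Carrier
  _[_] = coeff K

  -- A record around _≈ₚ_, so that the polynomials can be inferred from a proof of equality.
  record _≋_ (P Q : Poly K) : Set ℓ where
    constructor mk≋
    field at : ∀ n → P [ n ] ≈ Q [ n ]
  open _≋_ public

  ≋-isEquivalence : IsEquivalence _≋_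
  ≋-isEquivalence = record
    { refl  = mk≋ λ _ → refl
    ; sym   = λ e → mk≋ λ n → sym (at e n)
    ; trans = λ e f → mk≋ λ n → trans (at e n) (at f n)
    }
  private module E = IsEquivalence ≋-isEquivalence

  ∷-cong : ∀ {a b P Q} → a ≈ b → P ≋ Q → (a ∷ P) ≋ (b ∷ Q)
  ∷-cong e f .at zero    = e
  ∷-cong e f .at (suc n) = at f n

  ∷≋[] : ∀ {a P} → a ≈ 0# → P ≋ [] → (a ∷ P) ≋ []
  ∷≋[] e f .at zero    = e
  ∷≋[] e f .at (suc n) = at f n

  tail-≋ : ∀ {a b P Q} → (a ∷ P) ≋ (b ∷ Q) → P ≋ Q
  tail-≋ e .at n = at e (suc n)

  tail-≋[] : ∀ {a P} → (a ∷ P) ≋ [] → P ≋ []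
  tail-≋[] e .at n = at e (suc n)

  coeff-⊕ : ∀ P Q n → (P ⊕ Q) [ n ] ≈ P [ n ] + Q [ n ]
  coeff-⊕ []      Q       n       = sym (+-identityˡ _)
  coeff-⊕ (a ∷ P) []      n       = sym (+-identityʳ _)
  coeff-⊕ (a ∷ P) (b ∷ Q) zero    = refl
  coeff-⊕ (a ∷ P) (b ∷ Q) (suc n) = coeff-⊕ P Q n

  coeff-⊙ : ∀ a P n → (a ⊙ P) [ n ] ≈ a * P [ n ]
  coeff-⊙ a []      n       = sym (zeroʳ a)
  coeff-⊙ a (b ∷ P) zero    = refl
  coeff-⊙ a (b ∷ P) (suc n) = coeff-⊙ a P n

  coeff-⊖ : ∀ P n → (⊖ P) [ n ] ≈ - P [ n ]
  coeff-⊖ []      n       = sym -0#≈0#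
  coeff-⊖ (b ∷ P) zero    = refl
  coeff-⊖ (b ∷ P) (suc n) = coeff-⊖ P n

  ⊕-cong : ∀ {P P′ Q Q′} → P ≋ P′ → Q ≋ Q′ → P ⊕ Q ≋ P′ ⊕ Q′
  ⊕-cong {P} {P′} {Q} {Q′} e f .at n =
    trans (coeff-⊕ P Q n) (trans (+-cong (at e n) (at f n)) (sym (coeff-⊕ P′ Q′ n)))

  ⊙-cong : ∀ {a b P Q} → a ≈ b → P ≋ Q → a ⊙ P ≋ b ⊙ Q
  ⊙-cong {a} {b} {P} {Q} e f .at n =
    trans (coeff-⊙ a P n) (trans (*-cong e (at f n)) (sym (coeff-⊙ b Q n)))

  ⊖-cong : ∀ {P Q} → P ≋ Q → ⊖ P ≋ ⊖ Q
  ⊖-cong {P} {Q} e .at n = trans (coeff-⊖ P n) (trans (-‿cong (at e n)) (sym (coeff-⊖ Q n)))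

  ⊕-assoc : ∀ P Q R → (P ⊕ Q) ⊕ R ≋ P ⊕ (Q ⊕ R)
  ⊕-assoc P Q R .at n = begin
    ((P ⊕ Q) ⊕ R) [ n ]              ≈⟨ coeff-⊕ (P ⊕ Q) R n ⟩
    (P ⊕ Q) [ n ] + R [ n ]          ≈⟨ +-congʳ (coeff-⊕ P Q n) ⟩
    P [ n ] + Q [ n ] + R [ n ]      ≈⟨ +-assoc _ _ _ ⟩
    P [ n ] + (Q [ n ] + R [ n ])    ≈⟨ +-congˡ (coeff-⊕ Q R n) ⟨
    P [ n ] + (Q ⊕ R) [ n ]          ≈⟨ coeff-⊕ P (Q ⊕ R) n ⟨
    (P ⊕ (Q ⊕ R)) [ n ]              ∎
    where open ≈-Reasoning

  ⊕-comm : ∀ P Q → P ⊕ Q ≋ Q ⊕ P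
  ⊕-comm P Q .at n = trans (coeff-⊕ P Q n) (trans (+-comm _ _) (sym (coeff-⊕ Q P n)))

  ⊕-identityʳ : ∀ P → P ⊕ [] ≋ P
  ⊕-identityʳ P = ⊕-comm P []

  ⊖-inverseʳ : ∀ P → P ⊕ (⊖ P) ≋ []
  ⊖-inverseʳ P .at n =
    trans (coeff-⊕ P (⊖ P) n) (trans (+-congˡ (coeff-⊖ P n)) (-‿inverseʳ _))

  ⊕-middle : ∀ P Q R S → (P ⊕ Q) ⊕ (R ⊕ S) ≋ (P ⊕ R) ⊕ (Q ⊕ S)
  ⊕-middle P Q R S .at n = begin
    ((P ⊕ Q) ⊕ (R ⊕ S)) [ n ]                  ≈⟨ coeff-⊕ (P ⊕ Q) (R ⊕ S) n ⟩
    (P ⊕ Q) [ n ] + (R ⊕ S) [ n ]              ≈⟨ +-cong (coeff-⊕ P Q n) (coeff-⊕ R S n) ⟩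
    P [ n ] + Q [ n ] + (R [ n ] + S [ n ])    ≈⟨ solve 4 (λ p q r s → p :+ q :+ (r :+ s) := p :+ r :+ (q :+ s)) refl _ _ _ _ ⟩
    P [ n ] + R [ n ] + (Q [ n ] + S [ n ])    ≈⟨ +-cong (coeff-⊕ P R n) (coeff-⊕ Q S n) ⟨
    (P ⊕ R) [ n ] + (Q ⊕ S) [ n ]              ≈⟨ coeff-⊕ (P ⊕ R) (Q ⊕ S) n ⟨
    ((P ⊕ R) ⊕ (Q ⊕ S)) [ n ]                  ∎
    where open ≈-Reasoning

  ⊙-distribˡ : ∀ a P Q → a ⊙ (P ⊕ Q) ≋ a ⊙ P ⊕ a ⊙ Q
  ⊙-distribˡ a P Q .at n = begin
    (a ⊙ (P ⊕ Q)) [ n ]              ≈⟨ coeff-⊙ a (P ⊕ Q) n ⟩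
    a * (P ⊕ Q) [ n ]                ≈⟨ *-congˡ (coeff-⊕ P Q n) ⟩
    a * (P [ n ] + Q [ n ])          ≈⟨ distribˡ _ _ _ ⟩
    a * P [ n ] + a * Q [ n ]        ≈⟨ +-cong (coeff-⊙ a P n) (coeff-⊙ a Q n) ⟨
    (a ⊙ P) [ n ] + (a ⊙ Q) [ n ]    ≈⟨ coeff-⊕ (a ⊙ P) (a ⊙ Q) n ⟨
    (a ⊙ P ⊕ a ⊙ Q) [ n ]            ∎
    where open ≈-Reasoning

  ⊙-distribʳ : ∀ a b P → (a + b) ⊙ P ≋ a ⊙ P ⊕ b ⊙ P
  ⊙-distribʳ a b P .at n = begin
    ((a + b) ⊙ P) [ n ]              ≈⟨ coeff-⊙ (a + b) P n ⟩
    (a + b) * P [ n ]                ≈⟨ distribʳ _ _ _ ⟩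
    a * P [ n ] + b * P [ n ]        ≈⟨ +-cong (coeff-⊙ a P n) (coeff-⊙ b P n) ⟨
    (a ⊙ P) [ n ] + (b ⊙ P) [ n ]    ≈⟨ coeff-⊕ (a ⊙ P) (b ⊙ P) n ⟨
    (a ⊙ P ⊕ b ⊙ P) [ n ]            ∎
    where open ≈-Reasoning

  ⊙-assoc : ∀ a b P → a ⊙ (b ⊙ P) ≋ (a * b) ⊙ P
  ⊙-assoc a b P .at n = begin
    (a ⊙ (b ⊙ P)) [ n ]  ≈⟨ coeff-⊙ a (b ⊙ P) n ⟩
    a * (b ⊙ P) [ n ]    ≈⟨ *-congˡ (coeff-⊙ b P n) ⟩
    a * (b * P [ n ])    ≈⟨ *-assoc _ _ _ ⟨
    a * b * P [ n ]      ≈⟨ coeff-⊙ (a * b) P n ⟨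
    ((a * b) ⊙ P) [ n ]  ∎
    where open ≈-Reasoning

  1⊙ : ∀ P → 1# ⊙ P ≋ P
  1⊙ P .at n = trans (coeff-⊙ 1# P n) (*-identityˡ _)

  0⊙ : ∀ {a} P → a ≈ 0# → a ⊙ P ≋ []
  0⊙ {a} P e .at n = trans (coeff-⊙ a P n) (trans (*-congʳ e) (zeroˡ _))

  polySetoid : Setoid c ℓ
  polySetoid = record { Carrier = Poly K ; _≈_ = _≋_ ; isEquivalence = ≋-isEquivalence }

  module ≋-Reasoning = SetoidReasoning polySetoid

  0∷-⊕ : ∀ P Q → (0# ∷ P) ⊕ (0# ∷ Q) ≋ 0# ∷ (P ⊕ Q)
  0∷-⊕ P Q = ∷-cong (+-identityˡ 0#) E.refl

  ≋[]-⊛ : ∀ {P} Q → P ≋ [] → P ⊛ Q ≋ []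
  ≋[]-⊛ {[]}    Q e = E.refl
  ≋[]-⊛ {a ∷ P} Q e = ⊕-cong (0⊙ Q (at e 0)) (∷≋[] refl (≋[]-⊛ Q (tail-≋[] e)))

  ⊛-congʳ : ∀ {P P′} Q → P ≋ P′ → P ⊛ Q ≋ P′ ⊛ Q
  ⊛-congʳ {[]}    {P′}     Q e = E.sym (≋[]-⊛ Q (E.sym e))
  ⊛-congʳ {a ∷ P} {[]}     Q e = ≋[]-⊛ Q e
  ⊛-congʳ {a ∷ P} {b ∷ P′} Q e =
    ⊕-cong (⊙-cong {P = Q} (at e 0) E.refl) (∷-cong refl (⊛-congʳ Q (tail-≋ e)))

  ⊛-congˡ : ∀ P {Q Q′} → Q ≋ Q′ → P ⊛ Q ≋ P ⊛ Q′
  ⊛-congˡ []      e = E.refl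
  ⊛-congˡ (a ∷ P) e = ⊕-cong (⊙-cong refl e) (∷-cong refl (⊛-congˡ P e))

  ⊛-distribʳ : ∀ R P Q → (P ⊕ Q) ⊛ R ≋ P ⊛ R ⊕ Q ⊛ R
  ⊛-distribʳ R []      Q       = E.refl
  ⊛-distribʳ R (a ∷ P) []      = E.sym (⊕-identityʳ _)
  ⊛-distribʳ R (a ∷ P) (b ∷ Q) = begin
    (a + b) ⊙ R ⊕ (0# ∷ (P ⊕ Q) ⊛ R)
      ≈⟨ ⊕-cong (⊙-distribʳ a b R) (∷-cong refl (⊛-distribʳ R P Q)) ⟩
    (a ⊙ R ⊕ b ⊙ R) ⊕ (0# ∷ (P ⊛ R ⊕ Q ⊛ R))
      ≈⟨ ⊕-cong E.refl (0∷-⊕ (P ⊛ R) (Q ⊛ R)) ⟨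
    (a ⊙ R ⊕ b ⊙ R) ⊕ ((0# ∷ P ⊛ R) ⊕ (0# ∷ Q ⊛ R))
      ≈⟨ ⊕-middle (a ⊙ R) (b ⊙ R) _ _ ⟩
    (a ∷ P) ⊛ R ⊕ (b ∷ Q) ⊛ R ∎
    where open ≋-Reasoning

  ⊛-zeroʳ : ∀ P → P ⊛ [] ≋ []
  ⊛-zeroʳ []      = E.refl
  ⊛-zeroʳ (a ∷ P) = ∷≋[] refl (⊛-zeroʳ P)

  -- Multiplication recurses on its left factor; this mirrored unfolding of the right factor makes
  -- commutativity a single induction.
  ⊛-∷ : ∀ P b Q → P ⊛ (b ∷ Q) ≋ b ⊙ P ⊕ (0# ∷ P ⊛ Q)
  ⊛-∷ []      b Q = E.sym (∷≋[] refl E.refl)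
  ⊛-∷ (a ∷ P) b Q = ∷-cong (+-congʳ (*-comm a b)) (begin
    a ⊙ Q ⊕ P ⊛ (b ∷ Q)                ≈⟨ ⊕-cong E.refl (⊛-∷ P b Q) ⟩
    a ⊙ Q ⊕ (b ⊙ P ⊕ (0# ∷ P ⊛ Q))     ≈⟨ ⊕-assoc (a ⊙ Q) (b ⊙ P) _ ⟨
    (a ⊙ Q ⊕ b ⊙ P) ⊕ (0# ∷ P ⊛ Q)     ≈⟨ ⊕-cong (⊕-comm (a ⊙ Q) (b ⊙ P)) E.refl ⟩
    (b ⊙ P ⊕ a ⊙ Q) ⊕ (0# ∷ P ⊛ Q)     ≈⟨ ⊕-assoc (b ⊙ P) (a ⊙ Q) _ ⟩
    b ⊙ P ⊕ (a ⊙ Q ⊕ (0# ∷ P ⊛ Q))     ∎)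
    where open ≋-Reasoning

  ⊛-comm : ∀ P Q → P ⊛ Q ≋ Q ⊛ P
  ⊛-comm []      Q = E.sym (⊛-zeroʳ Q)
  ⊛-comm (a ∷ P) Q = E.trans (⊕-cong E.refl (∷-cong refl (⊛-comm P Q))) (E.sym (⊛-∷ Q a P))

  ⊙-⊛ : ∀ a P Q → (a ⊙ P) ⊛ Q ≋ a ⊙ (P ⊛ Q)
  ⊙-⊛ a []      Q = E.refl
  ⊙-⊛ a (b ∷ P) Q = begin
    (a * b) ⊙ Q ⊕ (0# ∷ (a ⊙ P) ⊛ Q)     ≈⟨ ⊕-cong (E.sym (⊙-assoc a b Q)) (∷-cong (sym (zeroʳ a)) (⊙-⊛ a P Q)) ⟩
    a ⊙ (b ⊙ Q) ⊕ a ⊙ (0# ∷ P ⊛ Q)       ≈⟨ ⊙-distribˡ a (b ⊙ Q) _ ⟨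
    a ⊙ (b ⊙ Q ⊕ (0# ∷ P ⊛ Q))           ∎
    where open ≋-Reasoning

  0∷-⊛ : ∀ P Q → (0# ∷ P) ⊛ Q ≋ 0# ∷ P ⊛ Q
  0∷-⊛ P Q = ⊕-cong (0⊙ Q refl) E.refl

  ⊛-assoc : ∀ P Q R → (P ⊛ Q) ⊛ R ≋ P ⊛ (Q ⊛ R)
  ⊛-assoc []      Q R = E.refl
  ⊛-assoc (a ∷ P) Q R = begin
    (a ⊙ Q ⊕ (0# ∷ P ⊛ Q)) ⊛ R           ≈⟨ ⊛-distribʳ R (a ⊙ Q) _ ⟩
    (a ⊙ Q) ⊛ R ⊕ (0# ∷ P ⊛ Q) ⊛ R       ≈⟨ ⊕-cong (⊙-⊛ a Q R) (0∷-⊛ (P ⊛ Q) R) ⟩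
    a ⊙ (Q ⊛ R) ⊕ (0# ∷ (P ⊛ Q) ⊛ R)     ≈⟨ ⊕-cong E.refl (∷-cong refl (⊛-assoc P Q R)) ⟩
    a ⊙ (Q ⊛ R) ⊕ (0# ∷ P ⊛ (Q ⊛ R))     ∎
    where open ≋-Reasoning

  ‹_› : Carrier → Poly K
  ‹ a › = a ∷ []

  const-⊛ : ∀ a P → ‹ a › ⊛ P ≋ a ⊙ P
  const-⊛ a P = E.trans (⊕-cong E.refl (∷≋[] refl E.refl)) (⊕-identityʳ _)

  -- Bundled for the semiring solver `PS`, which knows no subtraction: later calls pass `⊖ N` as a
  -- variable of its own and cancel it in a separate step.
  polyRing : CommutativeRing c ℓ
  polyRing = record
    { Carrier = Poly K ; _≈_ = _≋_ ; _+_ = _⊕_ ; _*_ = _⊛_ ; -_ = ⊖_ ; 0# = [] ; 1# = ‹ 1# ›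
    ; isCommutativeRing = record
      { isRing = record
        { +-isAbelianGroup = record
          { isGroup = record
            { isMonoid = record
              { isSemigroup = record
                { isMagma = record { isEquivalence = ≋-isEquivalence ; ∙-cong = ⊕-cong }
                ; assoc = ⊕-assoc }
              ; identity = (λ _ → E.refl) , ⊕-identityʳ }
            ; inverse = (λ P → E.trans (⊕-comm (⊖ P) P) (⊖-inverseʳ P)) , ⊖-inverseʳ
            ; ⁻¹-cong = ⊖-cong }
          ; comm = ⊕-comm }
        ; *-cong = λ {P} {P′} {Q} {Q′} e f → E.trans (⊛-congʳ Q e) (⊛-congˡ P′ f)
        ; *-assoc = ⊛-assoc
        ; *-identity = 1⊛ , λ P → E.trans (⊛-comm P ‹ 1# ›) (1⊛ P)
        ; distrib = (λ R P Q → E.trans (⊛-comm R (P ⊕ Q)) (E.trans (⊛-distribʳ R P Q)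
                      (⊕-cong (⊛-comm P R) (⊛-comm Q R)))) , ⊛-distribʳ }
      ; *-comm = ⊛-comm } }
    where
    1⊛ : ∀ P → ‹ 1# › ⊛ P ≋ P
    1⊛ P = E.trans (const-⊛ 1# P) (1⊙ P)

  module P = CommutativeRing polyRing
  module PS = NaturalSolver P.commutativeSemiring
  open PS public using () renaming (_:+_ to _⟨+⟩_; _:*_ to _⟨*⟩_; _:=_ to _⟨=⟩_)

  ⟦_⟧ : Poly K → Carrier → Carrier
  ⟦_⟧ = evalP

  eval-[] : ∀ P x → P ≋ [] → ⟦ P ⟧ x ≈ 0#
  eval-[] []      x e = refl
  eval-[] (a ∷ P) x e = begin
    a + x * ⟦ P ⟧ x  ≈⟨ +-cong (at e 0) (*-congˡ (eval-[] P x (tail-≋[] e))) ⟩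
    0# + x * 0#      ≈⟨ solve 1 (λ x → con 0 :+ x :* con 0 := con 0) refl x ⟩
    0#               ∎
    where open ≈-Reasoning

  eval-cong : ∀ P Q {x y} → P ≋ Q → x ≈ y → ⟦ P ⟧ x ≈ ⟦ Q ⟧ y
  eval-cong []      Q       e f = sym (eval-[] Q _ (E.sym e))
  eval-cong (a ∷ P) []      e f = eval-[] (a ∷ P) _ e
  eval-cong (a ∷ P) (b ∷ Q) e f = +-cong (at e 0) (*-cong f (eval-cong P Q (tail-≋ e) f))

  eval-⊕ : ∀ P Q x → ⟦ P ⊕ Q ⟧ x ≈ ⟦ P ⟧ x + ⟦ Q ⟧ x
  eval-⊕ []      Q       x = sym (+-identityˡ _)
  eval-⊕ (a ∷ P) []      x = sym (+-identityʳ _)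
  eval-⊕ (a ∷ P) (b ∷ Q) x = begin
    a + b + x * ⟦ P ⊕ Q ⟧ x              ≈⟨ +-congˡ (*-congˡ (eval-⊕ P Q x)) ⟩
    a + b + x * (⟦ P ⟧ x + ⟦ Q ⟧ x)      ≈⟨ solve 5 (λ a b x p q → a :+ b :+ x :* (p :+ q) := a :+ x :* p :+ (b :+ x :* q)) refl a b x _ _ ⟩
    a + x * ⟦ P ⟧ x + (b + x * ⟦ Q ⟧ x)  ∎
    where open ≈-Reasoning

  eval-⊙ : ∀ a P x → ⟦ a ⊙ P ⟧ x ≈ a * ⟦ P ⟧ x
  eval-⊙ a []      x = sym (zeroʳ a)
  eval-⊙ a (b ∷ P) x = begin
    a * b + x * ⟦ a ⊙ P ⟧ x    ≈⟨ +-congˡ (*-congˡ (eval-⊙ a P x)) ⟩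
    a * b + x * (a * ⟦ P ⟧ x)  ≈⟨ solve 4 (λ a b x p → a :* b :+ x :* (a :* p) := a :* (b :+ x :* p)) refl a b x _ ⟩
    a * (b + x * ⟦ P ⟧ x)      ∎
    where open ≈-Reasoning

  eval-⊛ : ∀ P Q x → ⟦ P ⊛ Q ⟧ x ≈ ⟦ P ⟧ x * ⟦ Q ⟧ x
  eval-⊛ []      Q x = sym (zeroˡ _)
  eval-⊛ (a ∷ P) Q x = begin
    ⟦ a ⊙ Q ⊕ (0# ∷ P ⊛ Q) ⟧ x                    ≈⟨ eval-⊕ (a ⊙ Q) (0# ∷ P ⊛ Q) x ⟩
    ⟦ a ⊙ Q ⟧ x + (0# + x * ⟦ P ⊛ Q ⟧ x)          ≈⟨ +-cong (eval-⊙ a Q x) (+-congˡ (*-congˡ (eval-⊛ P Q x))) ⟩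
    a * ⟦ Q ⟧ x + (0# + x * (⟦ P ⟧ x * ⟦ Q ⟧ x))  ≈⟨ solve 4 (λ a x p q → a :* q :+ (con 0 :+ x :* (p :* q)) := (a :+ x :* p) :* q) refl a x _ _ ⟩
    (a + x * ⟦ P ⟧ x) * ⟦ Q ⟧ x                   ∎
    where open ≈-Reasoning

  eval-const : ∀ a x → ⟦ ‹ a › ⟧ x ≈ a
  eval-const a x = trans (+-congˡ (zeroʳ x)) (+-identityʳ a)

-- Arithmetic of powers and integers in the field

module Field {c ℓ : Level} (K : ACField c ℓ) where
  open ACField K
  open import Algebra.Properties.Ring ring
  open NaturalSolver commutativeSemiring
    using (solve; _:=_; _:+_; _:*_; con)

  *-cancelˡ : ∀ {x y z} → x ≉ 0# → x * y ≈ x * z → y ≈ z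
  *-cancelˡ {x} {y} {z} x≉0 e = trans (sym (unit y)) (trans (*-congˡ e) (unit z))
    where
    open import Relation.Binary.Reasoning.Setoid setoid
    unit : ∀ y → x ⁻¹ * (x * y) ≈ y
    unit y = begin
      x ⁻¹ * (x * y)  ≈⟨ solve 3 (λ i x y → i :* (x :* y) := (x :* i) :* y) refl (x ⁻¹) x y ⟩
      x * x ⁻¹ * y    ≈⟨ *-congʳ (inverse x x≉0) ⟩
      1# * y          ≈⟨ *-identityˡ y ⟩
      y               ∎

  x*y≈0⇒y≈0 : ∀ {x y} → x ≉ 0# → x * y ≈ 0# → y ≈ 0#
  x*y≈0⇒y≈0 x≉0 e = *-cancelˡ x≉0 (trans e (sym (zeroʳ _)))

  *-≉0 : ∀ {x y} → x ≉ 0# → y ≉ 0# → x * y ≉ 0#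
  *-≉0 x≉0 y≉0 e = y≉0 (x*y≈0⇒y≈0 x≉0 e)

  -≉0 : ∀ {x} → x ≉ 0# → - x ≉ 0#
  -≉0 {x} x≉0 e = x≉0 (trans (sym (-‿involutive x)) (trans (-‿cong e) -0#≈0#))

  ^-cong : ∀ {x y} n → x ≈ y → x ^ n ≈ y ^ n
  ^-cong zero    e = refl
  ^-cong (suc n) e = *-cong e (^-cong n e)

  ^-≉0 : ∀ {x} n → x ≉ 0# → x ^ n ≉ 0#
  ^-≉0 zero    x≉0 = 1≉0
  ^-≉0 (suc n) x≉0 = *-≉0 x≉0 (^-≉0 n x≉0)

  ^-+ : ∀ x m n → x ^ (m ℕ.+ n) ≈ x ^ m * x ^ n
  ^-+ x zero    n = sym (*-identityˡ _)
  ^-+ x (suc m) n = trans (*-congˡ (^-+ x m n)) (sym (*-assoc _ _ _))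

  *-^ : ∀ x y n → (x * y) ^ n ≈ x ^ n * y ^ n
  *-^ x y zero    = sym (*-identityˡ _)
  *-^ x y (suc n) = trans (*-congˡ (*-^ x y n))
    (solve 4 (λ x y a b → x :* y :* (a :* b) := x :* a :* (y :* b)) refl x y _ _)

  1^ : ∀ n → 1# ^ n ≈ 1#
  1^ zero    = refl
  1^ (suc n) = trans (*-identityˡ _) (1^ n)

  ^-* : ∀ x m n → (x ^ m) ^ n ≈ x ^ (m ℕ.* n)
  ^-* x zero    n = 1^ n
  ^-* x (suc m) n = begin
    (x * x ^ m) ^ n        ≈⟨ *-^ x (x ^ m) n ⟩
    x ^ n * (x ^ m) ^ n    ≈⟨ *-congˡ (^-* x m n) ⟩
    x ^ n * x ^ (m ℕ.* n)  ≈⟨ ^-+ x n (m ℕ.* n) ⟨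
    x ^ (n ℕ.+ m ℕ.* n)    ∎
    where open import Relation.Binary.Reasoning.Setoid setoid

  ^-≡ : ∀ x {m n} → m ≡ n → x ^ m ≈ x ^ n
  ^-≡ x ≡.refl = refl

  ^-comm : ∀ x m n → (x ^ m) ^ n ≈ (x ^ n) ^ m
  ^-comm x m n = trans (^-* x m n) (trans (^-≡ x (ℕ.*-comm m n)) (sym (^-* x n m)))

  fromℕ-+ : ∀ m n → fromℕ (m ℕ.+ n) ≈ fromℕ m + fromℕ n
  fromℕ-+ zero    n = sym (+-identityˡ _)
  fromℕ-+ (suc m) n = trans (+-congˡ (fromℕ-+ m n)) (sym (+-assoc _ _ _))

  fromℕ-* : ∀ m n → fromℕ (m ℕ.* n) ≈ fromℕ m * fromℕ n
  fromℕ-* zero    n = sym (zeroˡ _)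
  fromℕ-* (suc m) n = begin
    fromℕ (n ℕ.+ m ℕ.* n)            ≈⟨ fromℕ-+ n (m ℕ.* n) ⟩
    fromℕ n + fromℕ (m ℕ.* n)        ≈⟨ +-congˡ (fromℕ-* m n) ⟩
    fromℕ n + fromℕ m * fromℕ n      ≈⟨ solve 2 (λ m n → n :+ m :* n := (con 1 :+ m) :* n) refl _ _ ⟩
    (1# + fromℕ m) * fromℕ n         ∎
    where open import Relation.Binary.Reasoning.Setoid setoid

  fromℕ-^ : ∀ m n → fromℕ (m ℕ.^ n) ≈ fromℕ m ^ n
  fromℕ-^ m zero    = +-identityʳ 1#
  fromℕ-^ m (suc n) = trans (fromℕ-* m (m ℕ.^ n)) (*-congˡ (fromℕ-^ m n))

  fromℕ-injective : ∀ m n → fromℕ m ≈ fromℕ n → m ≡ n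
  fromℕ-injective zero    zero    e = ≡.refl
  fromℕ-injective zero    (suc n) e = ⊥-elim (char0 n (sym e))
  fromℕ-injective (suc m) zero    e = ⊥-elim (char0 m e)
  fromℕ-injective (suc m) (suc n) e = ≡.cong suc (fromℕ-injective m n (+-cancelˡ _ _ _ e))

-- Linear factors and multiplicities of roots

module LocalFactors {c ℓ : Level} (K : ACField c ℓ) where
  open ACField K
  open Polynomials K
  open Field K
  open import Algebra.Properties.Ring ring
  open NaturalSolver commutativeSemiring
    using (solve; _:=_; _:+_; _:*_; con)

  lin : Carrier → Poly K
  lin α = - α ∷ 1# ∷ []

  lp : Carrier → ℕ → Poly K
  lp = linPow K

  lin-⊛ : ∀ α F → lin α ⊛ F ≋ (- α) ⊙ F ⊕ (0# ∷ F)
  lin-⊛ α F = P.+-congˡ {(- α) ⊙ F} (∷-cong refl (P.*-identityˡ F))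

  eval-lin : ∀ α x → ⟦ lin α ⟧ x ≈ x - α
  eval-lin α x = begin
    - α + x * (1# + x * 0#) ≈⟨ solve 2 (λ n x → n :+ x :* (con 1 :+ x :* con 0) := x :+ n) refl (- α) x ⟩
    x - α                   ∎
    where open ≈-Reasoning

  eval-lin-root : ∀ α → ⟦ lin α ⟧ α ≈ 0#
  eval-lin-root α = trans (eval-lin α α) (-‿inverseʳ α)

  lin-cong : ∀ {α β} → α ≈ β → lin α ≋ lin β
  lin-cong e = ∷-cong (-‿cong e) P.refl

  lp-cong : ∀ {α β} m → α ≈ β → lp α m ≋ lp β m
  lp-cong zero    e = P.refl
  lp-cong (suc m) e = P.*-cong (lin-cong e) (lp-cong m e)

  lp-+ : ∀ α m n → lp α (m ℕ.+ n) ≋ lp α m ⊛ lp α n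
  lp-+ α zero    n = P.sym (P.*-identityˡ (lp α n))
  lp-+ α (suc m) n = P.trans (P.*-congˡ {lin α} (lp-+ α m n)) (P.sym (P.*-assoc (lin α) (lp α m) (lp α n)))

  -- Coefficient n of the product is F_{n-1} - α F_n, so for α ≠ 0 the coefficients of F vanish one
  -- after the other from the constant term up. No degree of F, which exists only under a double
  -- negation, is involved.
  lin-⊛-cancel : ∀ {α} F → α ≉ 0# → lin α ⊛ F ≋ [] → F ≋ []
  lin-⊛-cancel {α} F α≉0 e .at n = go n
    where
    eqn : ∀ n → - α * F [ n ] + (0# ∷ F) [ n ] ≈ 0#
    eqn n = trans (+-congʳ (sym (coeff-⊙ (- α) F n)))
      (trans (sym (coeff-⊕ ((- α) ⊙ F) (0# ∷ F) n))
      (trans (sym (at (lin-⊛ α F) n)) (at e n)))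

    go : ∀ n → F [ n ] ≈ 0#
    go zero    = x*y≈0⇒y≈0 (-≉0 α≉0) (trans (sym (+-identityʳ _)) (eqn 0))
    go (suc n) = x*y≈0⇒y≈0 (-≉0 α≉0)
      (trans (sym (+-identityʳ _)) (trans (+-congˡ (sym (go n))) (eqn (suc n))))

  lp-⊛-cancel : ∀ {α} m F → α ≉ 0# → lp α m ⊛ F ≋ [] → F ≋ []
  lp-⊛-cancel zero    F α≉0 e = P.trans (P.sym (P.*-identityˡ F)) e
  lp-⊛-cancel {α} (suc m) F α≉0 e = lp-⊛-cancel m F α≉0
    (lin-⊛-cancel _ α≉0 (P.trans (P.sym (P.*-assoc (lin α) (lp α m) F)) e))

  -- Synthetic division by x - α: the coefficients are the Horner values at α of the successive
  -- tails of the list.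
  quotient : Carrier → Poly K → Poly K
  quotient α []          = []
  quotient α (a ∷ [])    = []
  quotient α (a ∷ b ∷ P) = ⟦ b ∷ P ⟧ α ∷ quotient α (b ∷ P)

  length-quotient : ∀ α a P → length (quotient α (a ∷ P)) ≡ length P
  length-quotient α a []      = ≡.refl
  length-quotient α a (b ∷ P) = ≡.cong suc (length-quotient α b P)

  quotient-eq : ∀ α P → P ≋ lin α ⊛ quotient α P ⊕ ‹ ⟦ P ⟧ α ›
  quotient-eq α []       = P.sym (∷≋[] (trans (+-congʳ {0#} refl) (+-identityʳ 0#))
                             (∷≋[] refl P.refl))
  quotient-eq α (a ∷ []) = ∷-cong
      (solve 2 (λ a x → a := con 0 :+ (a :+ x :* con 0)) refl a α) (P.sym (∷≋[] refl P.refl))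
  quotient-eq α (a ∷ b ∷ P) = P.sym (begin
    lin α ⊛ (e ∷ Q) ⊕ ‹ a + α * e ›                     ≈⟨ P.+-congʳ {‹ a + α * e ›} (⊛-∷ (lin α) e Q) ⟩
    (e ⊙ lin α ⊕ (0# ∷ lin α ⊛ Q)) ⊕ ‹ a + α * e ›
      ≈⟨ ∷-cong head≈ (P.trans (⊕-identityʳ _)
           (P.trans (P.+-congʳ {lin α ⊛ Q} (∷-cong (*-identityʳ e) P.refl)) (P.+-comm ‹ e › (lin α ⊛ Q)))) ⟩
    a ∷ (lin α ⊛ Q ⊕ ‹ e ›)                             ≈⟨ ∷-cong refl (quotient-eq α (b ∷ P)) ⟨
    a ∷ b ∷ P                                           ∎)
    where
    e = ⟦ b ∷ P ⟧ α
    Q = quotient α (b ∷ P)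
    open ≋-Reasoning
    head≈ : e * (- α) + 0# + (a + α * e) ≈ a
    head≈ = trans (solve 4 (λ e n a x → e :* n :+ con 0 :+ (a :+ x :* e) := a :+ e :* (x :+ n)) refl e (- α) a α)
      (trans (+-congˡ (trans (*-congˡ (-‿inverseʳ α)) (zeroʳ e))) (+-identityʳ a))

  factor : ∀ α P → ⟦ P ⟧ α ≈ 0# → P ≋ lin α ⊛ quotient α P
  factor α P e = P.trans (quotient-eq α P)
    (P.trans (P.+-congˡ {lin α ⊛ quotient α P} (∷≋[] e P.refl)) (⊕-identityʳ _))

  -- Unlike `Mult`, this keeps the cofactor: its value at α is the leading Taylor coefficient of P
  -- there, which the comparison around a cycle needs.
  record Factor (P : Poly K) (α : Carrier) (m : ℕ) (u : Poly K) : Set ℓ where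
    constructor mkFactor
    field
      equality : P ≋ lp α m ⊛ u
      value≉0  : ⟦ u ⟧ α ≉ 0#
  open Factor public

  -- Each division by x - α shortens the list by one, and N, a bound on the length, carries the
  -- recursion. Whether α is a root is undecidable, hence the double negation.
  factor-exists : ∀ α N P → length P ℕ.≤ N → ¬ (P ≋ []) → ¬ ¬ (∃ λ m → ∃ λ u → Factor P α m u)
  factor-exists α N []      _ P≉0 _ = P≉0 P.refl
  factor-exists α (suc N) (a ∷ P) (s≤s le) P≉0 k = ¬¬-excluded-middle λ where
    (no  r≉0) → k (0 , a ∷ P , mkFactor (P.sym (P.*-identityˡ (a ∷ P))) r≉0)
    (yes r≈0) → factor-exists α N (quotient α (a ∷ P))
      (≡.subst (ℕ._≤ N) (≡.sym (length-quotient α a P)) le)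
      (λ e → P≉0 (P.trans (factor α (a ∷ P) r≈0) (P.trans (P.*-congˡ {lin α} e) (⊛-zeroʳ (lin α)))))
      (λ { (m , u , fac) → k (suc m , u , mkFactor
         (P.trans (factor α (a ∷ P) r≈0) (P.trans (P.*-congˡ {lin α} (equality fac))
           (P.sym (P.*-assoc (lin α) (lp α m) u)))) (value≉0 fac)) })

  factor⇒≉[] : ∀ {P α m u} → α ≉ 0# → Factor P α m u → ¬ (P ≋ [])
  factor⇒≉[] {α = α} {m} {u} α≉0 fac e =
    value≉0 fac (eval-[] u α (lp-⊛-cancel m u α≉0 (P.trans (P.sym (equality fac)) e)))

  factor-root : ∀ {P α m u} → 0 ℕ.< m → Factor P α m u → ⟦ P ⟧ α ≈ 0#
  factor-root {P} {α} {suc m} {u} _ fac = begin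
    ⟦ P ⟧ α                                   ≈⟨ eval-cong P (lp α (suc m) ⊛ u) (equality fac) refl ⟩
    ⟦ lin α ⊛ lp α m ⊛ u ⟧ α                  ≈⟨ eval-⊛ (lin α ⊛ lp α m) u α ⟩
    ⟦ lin α ⊛ lp α m ⟧ α * ⟦ u ⟧ α            ≈⟨ *-congʳ (eval-⊛ (lin α) (lp α m) α) ⟩
    ⟦ lin α ⟧ α * ⟦ lp α m ⟧ α * ⟦ u ⟧ α      ≈⟨ *-congʳ (*-congʳ (eval-lin-root α)) ⟩
    0# * ⟦ lp α m ⟧ α * ⟦ u ⟧ α               ≈⟨ solve 2 (λ x y → con 0 :* x :* y := con 0) refl _ _ ⟩
    0#                                        ∎
    where open ≈-Reasoning

  factor-cong : ∀ {P α β m u} → α ≈ β → Factor P α m u → Factor P β m u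
  factor-cong {m = m} {u} e (mkFactor eq v) = mkFactor
    (P.trans eq (P.*-congʳ {u} (lp-cong m e))) (λ z → v (trans (eval-cong u u P.refl e) z))

  Mult⇒Factor : ∀ {P α m} → Mult K P α m → ∃ λ u → Factor P α m u
  Mult⇒Factor {P} {α} {m} ((Q , e) , maximal) = Q , mkFactor (P.trans (P.sym (mk≋ e)) (P.*-comm Q (lp α m)))
    λ z → maximal (quotient α Q , at (begin
      quotient α Q ⊛ (lin α ⊛ lp α m)   ≈⟨ PS.solve 3 (λ q l r → q ⟨*⟩ (l ⟨*⟩ r) ⟨=⟩ l ⟨*⟩ q ⟨*⟩ r) P.refl (quotient α Q) (lin α) (lp α m) ⟩
      lin α ⊛ quotient α Q ⊛ lp α m     ≈⟨ P.*-congʳ {lp α m} (factor α Q z) ⟨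
      Q ⊛ lp α m                        ≈⟨ mk≋ e ⟩
      P                                 ∎))
    where open ≋-Reasoning

  low-vanishes : ∀ {α} e F G → α ≉ 0# → lp α e ⊛ (F ⊕ lin α ⊛ G) ≋ [] → ⟦ F ⟧ α ≈ 0#
  low-vanishes {α} e F G α≉0 eq = begin
    ⟦ F ⟧ α                              ≈⟨ solve 2 (λ f g → f := f :+ con 0 :* g) refl _ (⟦ G ⟧ α) ⟩
    ⟦ F ⟧ α + 0# * ⟦ G ⟧ α               ≈⟨ +-congˡ (*-congʳ (eval-lin-root α)) ⟨
    ⟦ F ⟧ α + ⟦ lin α ⟧ α * ⟦ G ⟧ α      ≈⟨ +-congˡ (eval-⊛ (lin α) G α) ⟨
    ⟦ F ⟧ α + ⟦ lin α ⊛ G ⟧ α            ≈⟨ eval-⊕ F (lin α ⊛ G) α ⟨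
    ⟦ F ⊕ lin α ⊛ G ⟧ α                  ≈⟨ eval-[] _ α (lp-⊛-cancel e _ α≉0 eq) ⟩
    0#                                   ∎
    where open ≈-Reasoning

  -- Divide by (x - α)^X and evaluate at α: only A survives. So a vanishing sum cannot have a single
  -- summand of lowest multiplicity.
  lowest-term : ∀ {α} {X Y Z} A B C → α ≉ 0# → X ℕ.< Y → X ℕ.< Z →
                lp α X ⊛ A ⊕ lp α Y ⊛ B ⊕ lp α Z ⊛ C ≋ [] → ⟦ A ⟧ α ≈ 0#
  lowest-term {α} {X} {Y} {Z} A B C α≉0 X<Y X<Z eq
    with ℕ.m≤n⇒∃[o]m+o≡n X<Y | ℕ.m≤n⇒∃[o]m+o≡n X<Z
  ... | i , ≡.refl | j , ≡.refl = low-vanishes X A (lp α i ⊛ B ⊕ lp α j ⊛ C) α≉0 (begin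
    lp α X ⊛ (A ⊕ lin α ⊛ (lp α i ⊛ B ⊕ lp α j ⊛ C))
      ≈⟨ PS.solve 7 (λ x l i j a b c → x ⟨*⟩ (a ⟨+⟩ l ⟨*⟩ (i ⟨*⟩ b ⟨+⟩ j ⟨*⟩ c)) ⟨=⟩ x ⟨*⟩ a ⟨+⟩ l ⟨*⟩ (x ⟨*⟩ i) ⟨*⟩ b ⟨+⟩ l ⟨*⟩ (x ⟨*⟩ j) ⟨*⟩ c)
           P.refl (lp α X) (lin α) (lp α i) (lp α j) A B C ⟩
    lp α X ⊛ A ⊕ lin α ⊛ (lp α X ⊛ lp α i) ⊛ B ⊕ lin α ⊛ (lp α X ⊛ lp α j) ⊛ C
      ≈⟨ P.+-cong (P.+-congˡ {lp α X ⊛ A} (P.*-congʳ {B} (P.*-congˡ {lin α} (lp-+ α X i))))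
           (P.*-congʳ {C} (P.*-congˡ {lin α} (lp-+ α X j))) ⟨
    lp α X ⊛ A ⊕ lp α (suc X ℕ.+ i) ⊛ B ⊕ lp α (suc X ℕ.+ j) ⊛ C
      ≈⟨ eq ⟩
    [] ∎)
    where open ≋-Reasoning

  -- For maximality, subtract the two factorizations and cancel (x - α)^m; what remains says u(α) =
  -- 0.
  Factor⇒Mult : ∀ {P α m u} → α ≉ 0# → Factor P α m u → Mult K P α m
  Factor⇒Mult {P} {α} {m} {u} α≉0 (mkFactor eq v) =
    (u , at (P.trans (P.*-comm u (lp α m)) (P.sym eq))) , λ where
      (Q , e) → v (low-vanishes m u (⊖ Q) α≉0 (begin
        lp α m ⊛ (u ⊕ lin α ⊛ ⊖ Q)
          ≈⟨ PS.solve 4 (λ x u l q → x ⟨*⟩ (u ⟨+⟩ l ⟨*⟩ q) ⟨=⟩ x ⟨*⟩ u ⟨+⟩ q ⟨*⟩ (l ⟨*⟩ x)) P.refl (lp α m) u (lin α) (⊖ Q) ⟩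
        lp α m ⊛ u ⊕ ⊖ Q ⊛ lp α (suc m)
          ≈⟨ P.+-congʳ {⊖ Q ⊛ lp α (suc m)} (P.trans (P.sym eq) (P.sym (mk≋ e))) ⟩
        Q ⊛ lp α (suc m) ⊕ ⊖ Q ⊛ lp α (suc m)
          ≈⟨ P.distribʳ (lp α (suc m)) Q (⊖ Q) ⟨
        (Q ⊕ ⊖ Q) ⊛ lp α (suc m)
          ≈⟨ ≋[]-⊛ {Q ⊕ ⊖ Q} (lp α (suc m)) (⊖-inverseʳ Q) ⟩
        [] ∎))
    where open ≋-Reasoning

  -- Dividing by x - x 0 costs one coefficient and one point, and the remaining points are still
  -- roots of the quotient. An infinite sequence of points spares any counting.
  many-roots : ∀ N P → length P ℕ.≤ N → (x : ℕ → Carrier) →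
               (∀ i j → i ℕ.< j → x i ≉ x j) → (∀ i → ¬ ¬ (⟦ P ⟧ (x i) ≈ 0#)) → ¬ ¬ (P ≋ [])
  many-roots N       []      _        x distinct root k = k P.refl
  many-roots (suc N) (a ∷ P) (s≤s le) x distinct root k = root 0 λ r →
    many-roots N Q (≡.subst (ℕ._≤ N) (≡.sym (length-quotient (x 0) a P)) le) (λ i → x (suc i))
      (λ i j i<j → distinct (suc i) (suc j) (s≤s i<j))
      (λ i h → root (suc i) λ s → h (x*y≈0⇒y≈0
        (λ z → distinct 0 (suc i) (s≤s z≤n) (sym (x∙y⁻¹≈ε⇒x≈y _ _ z)))
        (trans (*-congʳ (sym (eval-lin (x 0) (x (suc i))))) (trans (sym (eval-⊛ (lin (x 0)) Q (x (suc i))))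
          (trans (sym (eval-cong (a ∷ P) _ (factor (x 0) (a ∷ P) r) refl)) s)))))
      (λ Q≋[] → k (P.trans (factor (x 0) (a ∷ P) r) (P.trans (P.*-congˡ {lin (x 0)} Q≋[]) (⊛-zeroʳ (lin (x 0))))))
    where
    Q = quotient (x 0) (a ∷ P)

-- The substitution of x^p for x and its effect on multiplicities

module Spread {c ℓ : Level} (K : ACField c ℓ) (q : ℕ) where
  open ACField K
  open Polynomials K
  open Field K
  open LocalFactors K
  open import Algebra.Properties.Ring ring
  open NaturalSolver commutativeSemiring
    using (solve; _:=_; _:+_; _:*_; con)
  open import Algebra.Properties.Ring P.ring using () renaming (+-cancelʳ to ⊕-cancelʳ)

  -- Given by its predecessor, so that the `p ∸ 1` in `spread` reduces to q.
  p : ℕ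
  p = suc q

  σ : Poly K → Poly K
  σ = Mahler.spread K p

  shift : ℕ → Poly K → Poly K
  shift k P = replicate k 0# ++ P

  shift-cong : ∀ k {P Q} → P ≋ Q → shift k P ≋ shift k Q
  shift-cong zero    e = e
  shift-cong (suc k) e = ∷-cong refl (shift-cong k e)

  shift-≋[] : ∀ k {P} → P ≋ [] → shift k P ≋ []
  shift-≋[] zero    e = e
  shift-≋[] (suc k) e = ∷≋[] refl (shift-≋[] k e)

  shift-⊕ : ∀ k P Q → shift k P ⊕ shift k Q ≋ shift k (P ⊕ Q)
  shift-⊕ zero    P Q = P.refl
  shift-⊕ (suc k) P Q = ∷-cong (+-identityʳ 0#) (shift-⊕ k P Q)

  shift-⊙ : ∀ k a P → a ⊙ shift k P ≋ shift k (a ⊙ P)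
  shift-⊙ zero    a P = P.refl
  shift-⊙ (suc k) a P = ∷-cong (zeroʳ a) (shift-⊙ k a P)

  shift-⊛ : ∀ k P Q → shift k P ⊛ Q ≋ shift k (P ⊛ Q)
  shift-⊛ zero    P Q = P.refl
  shift-⊛ (suc k) P Q = P.trans (0∷-⊛ (shift k P) Q) (∷-cong refl (shift-⊛ k P Q))

  xpow-⊛ : ∀ k P → xpow K k ⊛ P ≋ shift k P
  xpow-⊛ k P = P.trans (shift-⊛ k ‹ 1# › P) (shift-cong k (P.*-identityˡ P))

  eval-shift : ∀ k P x → ⟦ shift k P ⟧ x ≈ x ^ k * ⟦ P ⟧ x
  eval-shift zero    P x = sym (*-identityˡ _)
  eval-shift (suc k) P x = trans (+-identityˡ _)
    (trans (*-congˡ (eval-shift k P x)) (sym (*-assoc _ _ _)))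

  σ-≋[] : ∀ {P} → P ≋ [] → σ P ≋ []
  σ-≋[] {[]}    e = P.refl
  σ-≋[] {a ∷ P} e = ∷≋[] (at e 0) (shift-≋[] q (σ-≋[] (tail-≋[] e)))

  σ-cong : ∀ {P Q} → P ≋ Q → σ P ≋ σ Q
  σ-cong {[]}    {Q}     e = P.sym (σ-≋[] (P.sym e))
  σ-cong {a ∷ P} {[]}    e = σ-≋[] e
  σ-cong {a ∷ P} {b ∷ Q} e = ∷-cong (at e 0) (shift-cong q (σ-cong (tail-≋ e)))

  σ-⊕ : ∀ P Q → σ (P ⊕ Q) ≋ σ P ⊕ σ Q
  σ-⊕ []      Q       = P.refl
  σ-⊕ (a ∷ P) []      = P.sym (⊕-identityʳ _)
  σ-⊕ (a ∷ P) (b ∷ Q) = ∷-cong refl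
    (P.trans (shift-cong q (σ-⊕ P Q)) (P.sym (shift-⊕ q (σ P) (σ Q))))

  σ-⊙ : ∀ a P → σ (a ⊙ P) ≋ a ⊙ σ P
  σ-⊙ a []      = P.refl
  σ-⊙ a (b ∷ P) = ∷-cong refl (P.trans (shift-cong q (σ-⊙ a P)) (P.sym (shift-⊙ q a (σ P))))

  σ-⊛ : ∀ P Q → σ (P ⊛ Q) ≋ σ P ⊛ σ Q
  σ-⊛ []      Q = P.refl
  σ-⊛ (a ∷ P) Q = begin
    σ (a ⊙ Q ⊕ (0# ∷ P ⊛ Q))                  ≈⟨ σ-⊕ (a ⊙ Q) (0# ∷ P ⊛ Q) ⟩
    σ (a ⊙ Q) ⊕ (0# ∷ shift q (σ (P ⊛ Q)))
      ≈⟨ P.+-cong (σ-⊙ a Q) (∷-cong refl (P.trans (shift-cong q (σ-⊛ P Q)) (P.sym (shift-⊛ q (σ P) (σ Q))))) ⟩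
    a ⊙ σ Q ⊕ (0# ∷ shift q (σ P) ⊛ σ Q)      ∎
    where open ≋-Reasoning

  eval-σ : ∀ P x → ⟦ σ P ⟧ x ≈ ⟦ P ⟧ (x ^ p)
  eval-σ []      x = refl
  eval-σ (a ∷ P) x = +-congˡ (begin
    x * ⟦ shift q (σ P) ⟧ x      ≈⟨ *-congˡ (eval-shift q (σ P) x) ⟩
    x * (x ^ q * ⟦ σ P ⟧ x)      ≈⟨ *-assoc _ _ _ ⟨
    x ^ p * ⟦ σ P ⟧ x            ≈⟨ *-congˡ (eval-σ P x) ⟩
    x ^ p * ⟦ P ⟧ (x ^ p)        ∎)
    where open ≈-Reasoning

  -- The quotient (x^n - α^n) / (x - α), that is, the sum of all x^i α^j with i + j = n - 1.
  geometric : Carrier → ℕ → Poly K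
  geometric α zero    = []
  geometric α (suc n) = xpow K n ⊕ ‹ α › ⊛ geometric α n

  lin-geometric : ∀ α n → lin α ⊛ geometric α n ⊕ ‹ α ^ n › ≋ xpow K n
  lin-geometric α zero    = P.+-congʳ {‹ 1# ›} (⊛-zeroʳ (lin α))
  lin-geometric α (suc n) = begin
    lin α ⊛ (X ⊕ ‹ α › ⊛ G) ⊕ ‹ α * α ^ n ›
      ≈⟨ P.+-congˡ {lin α ⊛ (X ⊕ ‹ α › ⊛ G)} (const-⊛ α ‹ α ^ n ›) ⟨
    lin α ⊛ (X ⊕ ‹ α › ⊛ G) ⊕ ‹ α › ⊛ ‹ α ^ n ›
      ≈⟨ PS.solve 5 (λ l x a g e → l ⟨*⟩ (x ⟨+⟩ a ⟨*⟩ g) ⟨+⟩ a ⟨*⟩ e ⟨=⟩ l ⟨*⟩ x ⟨+⟩ a ⟨*⟩ (l ⟨*⟩ g ⟨+⟩ e))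
           P.refl (lin α) X ‹ α › G ‹ α ^ n › ⟩
    lin α ⊛ X ⊕ ‹ α › ⊛ (lin α ⊛ G ⊕ ‹ α ^ n ›)
      ≈⟨ P.+-cong (lin-⊛ α X) (P.trans (P.*-congˡ {‹ α ›} (lin-geometric α n)) (const-⊛ α X)) ⟩
    ((- α) ⊙ X ⊕ (0# ∷ X)) ⊕ α ⊙ X
      ≈⟨ PS.solve 3 (λ a b c → a ⟨+⟩ b ⟨+⟩ c ⟨=⟩ a ⟨+⟩ c ⟨+⟩ b) P.refl ((- α) ⊙ X) (0# ∷ X) (α ⊙ X) ⟩
    ((- α) ⊙ X ⊕ α ⊙ X) ⊕ (0# ∷ X)
      ≈⟨ P.+-congʳ {0# ∷ X} (P.trans (P.sym (⊙-distribʳ (- α) α X)) (0⊙ X (-‿inverseˡ α))) ⟩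
    0# ∷ X ∎
    where
    X = xpow K n
    G = geometric α n
    open ≋-Reasoning

  -- At x = α all n terms equal α^(n-1); the extra factor α avoids the exponent n - 1.
  eval-geometric : ∀ α n → ⟦ geometric α n ⟧ α * α ≈ fromℕ n * α ^ n
  eval-geometric α zero    = trans (zeroˡ _) (sym (zeroˡ _))
  eval-geometric α (suc n) = begin
    ⟦ xpow K n ⊕ ‹ α › ⊛ G ⟧ α * α
      ≈⟨ *-congʳ (trans (eval-⊕ (xpow K n) (‹ α › ⊛ G) α) (+-cong
           (trans (eval-shift n ‹ 1# › α) (*-congˡ (eval-const 1# α)))
           (trans (eval-⊛ ‹ α › G α) (*-congʳ (eval-const α α))))) ⟩
    (α ^ n * 1# + α * ⟦ G ⟧ α) * α
      ≈⟨ solve 3 (λ x a g → (x :* con 1 :+ a :* g) :* a := a :* (x :+ g :* a)) refl _ _ _ ⟩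
    α * (α ^ n + ⟦ G ⟧ α * α)
      ≈⟨ *-congˡ (+-congˡ (eval-geometric α n)) ⟩
    α * (α ^ n + fromℕ n * α ^ n)
      ≈⟨ solve 3 (λ x a f → a :* (x :+ f :* x) := (con 1 :+ f) :* (a :* x)) refl _ _ _ ⟩
    (1# + fromℕ n) * (α * α ^ n) ∎
    where
    G = geometric α n
    open ≈-Reasoning

  σ-lin : ∀ {α β} → β ≈ α ^ p → σ (lin β) ≋ lin α ⊛ geometric α p
  σ-lin {α} {β} e = ⊕-cancelʳ ‹ β › _ _ (begin
    σ (lin β) ⊕ ‹ β ›
      ≈⟨ ∷-cong (-‿inverseˡ β) (P.trans (⊕-identityʳ _) (shift-cong q (∷-cong refl (shift-≋[] q P.refl)))) ⟩
    xpow K p                               ≈⟨ lin-geometric α p ⟨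
    lin α ⊛ geometric α p ⊕ ‹ α ^ p ›      ≈⟨ P.+-congˡ {lin α ⊛ geometric α p} (∷-cong e P.refl) ⟨
    lin α ⊛ geometric α p ⊕ ‹ β ›          ∎)
    where open ≋-Reasoning

  power : Poly K → ℕ → Poly K
  power P zero    = ‹ 1# ›
  power P (suc n) = P ⊛ power P n

  eval-power : ∀ P n x → ⟦ power P n ⟧ x ≈ ⟦ P ⟧ x ^ n
  eval-power P zero    x = eval-const 1# x
  eval-power P (suc n) x = trans (eval-⊛ P (power P n) x) (*-congˡ (eval-power P n x))

  σ-lp : ∀ {α β} m → β ≈ α ^ p → σ (lp β m) ≋ lp α m ⊛ power (geometric α p) m
  σ-lp zero    e = P.trans (∷-cong refl (shift-≋[] q P.refl)) (P.sym (P.*-identityˡ ‹ 1# ›))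
  σ-lp {α} {β} (suc m) e = begin
    σ (lin β ⊛ lp β m)          ≈⟨ σ-⊛ (lin β) (lp β m) ⟩
    σ (lin β) ⊛ σ (lp β m)      ≈⟨ P.*-cong (σ-lin e) (σ-lp m e) ⟩
    (lin α ⊛ G) ⊛ (lp α m ⊛ power G m)
      ≈⟨ PS.solve 4 (λ l g r h → (l ⟨*⟩ g) ⟨*⟩ (r ⟨*⟩ h) ⟨=⟩ (l ⟨*⟩ r) ⟨*⟩ (g ⟨*⟩ h)) P.refl (lin α) G (lp α m) (power G m) ⟩
    (lin α ⊛ lp α m) ⊛ (G ⊛ power G m) ∎
    where
    G = geometric α p
    open ≋-Reasoning

  pK : Carrier
  pK = fromℕ p

  -- The derivative p α ^ (p - 1) of x ^ p, obtained as the value at α of (x ^ p - α ^ p) / (x - α).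
  slope : Carrier → Carrier
  slope α = ⟦ geometric α p ⟧ α

  slope-eq : ∀ {α γ} → γ ≈ α ^ p → slope α * α ≈ pK * γ
  slope-eq {α} e = trans (eval-geometric α p) (*-congˡ (sym e))

  -- Characteristic zero enters here: x ↦ x^p is unramified away from 0.
  slope≉0 : ∀ {α} → α ≉ 0# → slope α ≉ 0#
  slope≉0 {α} α≉0 e = *-≉0 (char0 q) (^-≉0 p α≉0)
    (trans (sym (eval-geometric α p)) (trans (*-congʳ e) (zeroˡ α)))

  σ-unit : Carrier → ℕ → Poly K → Poly K
  σ-unit α m u = power (geometric α p) m ⊛ σ u

  eval-σ-unit : ∀ {α γ} m u → γ ≈ α ^ p → ⟦ σ-unit α m u ⟧ α ≈ slope α ^ m * ⟦ u ⟧ γ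
  eval-σ-unit {α} m u e = trans (eval-⊛ (power (geometric α p) m) (σ u) α)
    (*-cong (eval-power (geometric α p) m α) (trans (eval-σ u α) (eval-cong u u P.refl (sym e))))

  -- Each factor x - γ of P becomes x^p - γ, which has α as a simple root; the m complementary
  -- factors go into the cofactor, each with value `slope α`.
  factor-σ : ∀ {P α γ m u} → α ≉ 0# → γ ≈ α ^ p → Factor P γ m u → Factor (σ P) α m (σ-unit α m u)
  factor-σ {P} {α} {γ} {m} {u} α≉0 e (mkFactor eq v) = mkFactor
    (begin
      σ P                                               ≈⟨ σ-cong eq ⟩
      σ (lp γ m ⊛ u)                                    ≈⟨ σ-⊛ (lp γ m) u ⟩
      σ (lp γ m) ⊛ σ u                                  ≈⟨ P.*-congʳ {σ u} (σ-lp m e) ⟩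
      (lp α m ⊛ power (geometric α p) m) ⊛ σ u          ≈⟨ P.*-assoc (lp α m) _ (σ u) ⟩
      lp α m ⊛ σ-unit α m u                             ∎)
    (λ z → *-≉0 (^-≉0 m (slope≉0 α≉0)) v (trans (sym (eval-σ-unit m u e)) z))
    where open ≋-Reasoning

  factor-⊛ : ∀ {P Q α m n u v} → Factor P α m u → Factor Q α n v → Factor (P ⊛ Q) α (m ℕ.+ n) (u ⊛ v)
  factor-⊛ {P} {Q} {α} {m} {n} {u} {v} (mkFactor e u≉0) (mkFactor f v≉0) = mkFactor
    (begin
      P ⊛ Q                              ≈⟨ P.*-cong e f ⟩
      (lp α m ⊛ u) ⊛ (lp α n ⊛ v)
        ≈⟨ PS.solve 4 (λ a b c d → (a ⟨*⟩ b) ⟨*⟩ (c ⟨*⟩ d) ⟨=⟩ (a ⟨*⟩ c) ⟨*⟩ (b ⟨*⟩ d)) P.refl (lp α m) u (lp α n) v ⟩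
      (lp α m ⊛ lp α n) ⊛ (u ⊛ v)        ≈⟨ P.*-congʳ {u ⊛ v} (lp-+ α m n) ⟨
      lp α (m ℕ.+ n) ⊛ (u ⊛ v)           ∎)
    (λ z → *-≉0 u≉0 v≉0 (trans (sym (eval-⊛ u v α)) z))
    where open ≋-Reasoning

  factor-const : ∀ {a} α → a ≉ 0# → Factor ‹ a › α 0 ‹ a ›
  factor-const {a} α a≉0 = mkFactor (P.sym (P.*-identityˡ ‹ a ›)) (λ z → a≉0 (trans (sym (eval-const a α)) z))

  three-term : ∀ {α A B C X Y Z u v w} → Factor A α X u → Factor B α Y v → Factor C α Z w →
               A ⊕ B ⊕ C ≋ [] → lp α X ⊛ u ⊕ lp α Y ⊛ v ⊕ lp α Z ⊛ w ≋ []
  three-term f g h e =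
    P.trans (P.sym (P.+-cong (P.+-cong (equality f) (equality g)) (equality h))) e

  not-lowest : ∀ {α A B C X Y Z u v w} → α ≉ 0# →
               Factor A α X u → Factor B α Y v → Factor C α Z w →
               A ⊕ B ⊕ C ≋ [] → X ℕ.< Y → X ℕ.< Z → ⊥
  not-lowest {u = u} {v} {w} α≉0 f g h e X<Y X<Z =
    value≉0 f (lowest-term u v w α≉0 X<Y X<Z (three-term f g h e))

  lowest-pair : ∀ {α A B C X Y u v w} → α ≉ 0# →
                Factor A α X u → Factor B α Y v → Factor C α Y w →
                A ⊕ B ⊕ C ≋ [] → Y ℕ.< X → ⟦ v ⟧ α + ⟦ w ⟧ α ≈ 0#
  lowest-pair {α} {X = X} {Y} {u} {v} {w} α≉0 f g h e Y<X =
    -- The two tied summands are merged into one, and the zero polynomial fills the third slot of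
    -- `lowest-term`.
    trans (sym (eval-⊕ v w α)) (lowest-term (v ⊕ w) u [] α≉0 Y<X Y<X (begin
      lp α Y ⊛ (v ⊕ w) ⊕ lp α X ⊛ u ⊕ lp α X ⊛ []
        ≈⟨ P.trans (P.+-congˡ {lp α Y ⊛ (v ⊕ w) ⊕ lp α X ⊛ u} (⊛-zeroʳ (lp α X))) (⊕-identityʳ _) ⟩
      lp α Y ⊛ (v ⊕ w) ⊕ lp α X ⊛ u
        ≈⟨ PS.solve 5 (λ y v w x u → y ⟨*⟩ (v ⟨+⟩ w) ⟨+⟩ x ⟨*⟩ u ⟨=⟩ x ⟨*⟩ u ⟨+⟩ y ⟨*⟩ v ⟨+⟩ y ⟨*⟩ w)
             P.refl (lp α Y) v w (lp α X) u ⟩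
      lp α X ⊛ u ⊕ lp α Y ⊛ v ⊕ lp α Y ⊛ w   ≈⟨ three-term f g h e ⟩
      [] ∎))
    where open ≋-Reasoning

  root : ∀ γ → ∃ λ α → α ^ p ≈ γ
  root γ with algClosed (- γ) (replicate q 0#) 1# 1≉0
  ... | α , e = α , x∙y⁻¹≈ε⇒x≈y _ _ (begin
    α ^ p - γ                        ≈⟨ +-comm _ _ ⟩
    - γ + α * α ^ q                  ≈⟨ +-congˡ (*-congˡ (trans (sym (*-identityʳ _)) (*-congˡ (sym (eval-const 1# α))))) ⟩
    - γ + α * (α ^ q * ⟦ ‹ 1# › ⟧ α) ≈⟨ +-congˡ (*-congˡ (eval-shift q ‹ 1# › α)) ⟨
    - γ + α * ⟦ xpow K q ⟧ α         ≈⟨ e ⟩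
    0#                               ∎)
    where open ≈-Reasoning

-- The Mahler equation at a single point: orders and leading coefficients

module Poles {c ℓ : Level} (K : ACField c ℓ) (q : ℕ) (f g : RatFun K) (κ : ACField.Carrier K) where
  open ACField K
  open Polynomials K
  open Field K
  open LocalFactors K
  open Spread K q hiding (p; pK)
  open Mahler K (suc q)
  open import Algebra.Properties.Ring ring
  open NaturalSolver commutativeSemiring
    using (solve; _:=_; _:+_; _:*_; con)

  p : ℕ
  p = suc q

  fn fd gn gd : Poly K
  fn = RatFun.num f
  fd = RatFun.den f
  gn = RatFun.num g
  gd = RatFun.den g

  -- The fraction need not be reduced, so both multiplicities may be positive. The values of u and v
  -- at α give the leading coefficient.
  record Germ (P Q : Poly K) (α : Carrier) : Set (c ⊔ ℓ) where
    constructor mkGerm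
    field
      {a b}  : ℕ
      {u v}  : Poly K
      numer  : Factor P α a u
      denom  : Factor Q α b v

  germ-exists : ∀ {P Q} α → ¬ (P ≋ []) → ¬ (Q ≋ []) → ¬ ¬ Germ P Q α
  germ-exists {P} {Q} α P≉0 Q≉0 k =
    factor-exists α _ P ℕ.≤-refl P≉0 λ (_ , _ , num) →
    factor-exists α _ Q ℕ.≤-refl Q≉0 λ (_ , _ , den) → k (mkGerm num den)

  germ-cong : ∀ {P Q α β} → α ≈ β → Germ P Q α → Germ P Q β
  germ-cong e (mkGerm num den) = mkGerm (factor-cong e num) (factor-cong e den)

  pole⇒germ : ∀ {α k} → PoleOfOrder f α k → ∃ λ (F : Germ fn fd α) → Germ.b F ≡ k ℕ.+ Germ.a F
  pole⇒germ (_ , _ , _ , num , den , e) =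
    mkGerm (proj₂ (Mult⇒Factor num)) (proj₂ (Mult⇒Factor den)) , e

  germ⇒pole : ∀ {α k} → α ≉ 0# → 0 ℕ.< k → (F : Germ fn fd α) → Germ.b F ≡ k ℕ.+ Germ.a F → PoleOfOrder f α k
  germ⇒pole α≉0 0<k (mkGerm num den) e =
    0<k , _ , _ , Factor⇒Mult α≉0 num , Factor⇒Mult α≉0 den , e

  IsPole-cong : ∀ {α β} → β ≉ 0# → α ≈ β → IsPole f α → IsPole f β
  IsPole-cong β≉0 e (k , pole) =
    k , germ⇒pole β≉0 (proj₁ pole) (germ-cong e (proj₁ (pole⇒germ pole))) (proj₂ (pole⇒germ pole))

  -- Multiplicities, unlike field elements, can be compared, so the absence of a pole becomes an
  -- inequality without a double negation.
  regular⇒≤ : ∀ {α} → α ≉ 0# → ¬ IsPole f α → (F : Germ fn fd α) → Germ.b F ℕ.≤ Germ.a F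
  regular⇒≤ α≉0 regular F with Germ.b F ℕ.≤? Germ.a F
  ... | yes b≤a = b≤a
  ... | no  b≰a = ⊥-elim (regular (Germ.b F ℕ.∸ Germ.a F , germ⇒pole α≉0 (ℕ.m<n⇒0<n∸m (ℕ.≰⇒> b≰a)) F
                    (≡.sym (ℕ.m∸n+n≡m (ℕ.<⇒≤ (ℕ.≰⇒> b≰a))))))

  module Equation
    (κ≉0 : κ ≉ 0#)
    (summable : (fn ⊛ (σ gd ⊛ gd)) ≋ ((κ ⊙ (σ gn ⊛ gd)) ⊕ ⊖ (gn ⊛ σ gd)) ⊛ fd)
    (fn≉0 : ¬ (fn ≋ [])) (fd≉0 : ¬ (fd ≋ [])) (gd≉0 : ¬ (gd ≋ []))
    where

    -- This is f + g - κσ(g) = 0 multiplied by all three denominators. The sign sits in the constant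
    -- `- κ`, which leaves a plain sum of three terms.
    equation : fn ⊛ (σ gd ⊛ gd) ⊕ gn ⊛ σ gd ⊛ fd ⊕ ‹ - κ › ⊛ (σ gn ⊛ gd ⊛ fd) ≋ []
    equation = begin
      fn ⊛ (σ gd ⊛ gd) ⊕ N ⊛ fd ⊕ ‹ - κ › ⊛ (S ⊛ fd)
        ≈⟨ P.+-congʳ {‹ - κ › ⊛ (S ⊛ fd)} (P.+-congʳ {N ⊛ fd} (P.trans summable
             (P.*-congʳ {fd} (P.+-congʳ {⊖ N} (P.sym (const-⊛ κ S)))))) ⟩
      (‹ κ › ⊛ S ⊕ ⊖ N) ⊛ fd ⊕ N ⊛ fd ⊕ ‹ - κ › ⊛ (S ⊛ fd)
        ≈⟨ PS.solve 6 (λ c d s n m f → (c ⟨*⟩ s ⟨+⟩ m) ⟨*⟩ f ⟨+⟩ n ⟨*⟩ f ⟨+⟩ d ⟨*⟩ (s ⟨*⟩ f) ⟨=⟩ (n ⟨+⟩ m) ⟨*⟩ f ⟨+⟩ (c ⟨+⟩ d) ⟨*⟩ (s ⟨*⟩ f))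
             P.refl ‹ κ › ‹ - κ › S N (⊖ N) fd ⟩
      (N ⊕ ⊖ N) ⊛ fd ⊕ (‹ κ › ⊕ ‹ - κ ›) ⊛ (S ⊛ fd)
        ≈⟨ P.+-cong (≋[]-⊛ {N ⊕ ⊖ N} fd (⊖-inverseʳ N))
             (≋[]-⊛ {‹ κ + - κ ›} (S ⊛ fd) (∷≋[] (-‿inverseʳ κ) P.refl)) ⟩
      [] ∎
      where
      N = gn ⊛ σ gd
      S = σ gn ⊛ gd
      open ≋-Reasoning

    -- If `gn` vanished, so would `fn ⊛ (σ gd ⊛ gd)`; but its three factors have finite
    -- multiplicities at α, hence so has their product.
    gn≉0 : ∀ {α} → α ≉ 0# → ¬ (gn ≋ [])
    gn≉0 {α} α≉0 gn≋[] =
      factor-exists α _ fn ℕ.≤-refl fn≉0 λ (_ , _ , x) →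
      factor-exists α _ gd ℕ.≤-refl gd≉0 λ (_ , _ , y) →
      factor-exists (α ^ p) _ gd ℕ.≤-refl gd≉0 λ (_ , _ , z) →
      factor⇒≉[] α≉0 (factor-⊛ x (factor-⊛ (factor-σ α≉0 refl z) y)) (P.trans summable
        (≋[]-⊛ {(κ ⊙ (σ gn ⊛ gd)) ⊕ ⊖ (gn ⊛ σ gd)} fd
          (P.+-cong (⊙-cong {P = σ gn ⊛ gd} refl (≋[]-⊛ {σ gn} gd (σ-≋[] gn≋[])))
            (⊖-cong (≋[]-⊛ {gn} (σ gd) gn≋[])))))

    module At {α γ : Carrier} (α≉0 : α ≉ 0#) (γ≈αᵖ : γ ≈ α ^ p)
              (F : Germ fn fd α) (G : Germ gn gd α) (G′ : Germ gn gd γ) where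
      open Germ F using () renaming (a to s; b to t; u to y; v to z; numer to fnF; denom to fdF)
      open Germ G using (a; b; u; v) renaming (numer to gnF; denom to gdF)
      open Germ G′ using () renaming (a to a′; b to b′; u to u′; v to v′; numer to gnF′; denom to gdF′)

      U V : Poly K
      U = σ-unit α a′ u′
      V = σ-unit α b′ v′

      -- Multiplicities at α of the summands of `equation` that stem from f, g and κσ(g). Over the
      -- common denominator, a smaller number means a worse pole.
      X Y Z : ℕ
      X = s ℕ.+ (b′ ℕ.+ b)
      Y = a ℕ.+ b′ ℕ.+ t
      Z = a′ ℕ.+ b ℕ.+ t

      factorX : Factor (fn ⊛ (σ gd ⊛ gd)) α X (y ⊛ (V ⊛ v))
      factorX = factor-⊛ fnF (factor-⊛ (factor-σ α≉0 γ≈αᵖ gdF′) gdF)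

      factorY : Factor (gn ⊛ σ gd ⊛ fd) α Y (u ⊛ V ⊛ z)
      factorY = factor-⊛ (factor-⊛ gnF (factor-σ α≉0 γ≈αᵖ gdF′)) fdF

      factorZ : Factor (‹ - κ › ⊛ (σ gn ⊛ gd ⊛ fd)) α Z (‹ - κ › ⊛ (U ⊛ v ⊛ z))
      factorZ = factor-⊛ (factor-const α (-≉0 κ≉0)) (factor-⊛ (factor-⊛ (factor-σ α≉0 γ≈αᵖ gnF′) gdF) fdF)

      private
        rotate : ∀ A B C → A ⊕ B ⊕ C ≋ [] → B ⊕ C ⊕ A ≋ []
        rotate A B C e = P.trans (P.trans (P.+-comm (B ⊕ C) A) (P.sym (P.+-assoc A B C))) e
        equationY = rotate (fn ⊛ (σ gd ⊛ gd)) (gn ⊛ σ gd ⊛ fd) (‹ - κ › ⊛ (σ gn ⊛ gd ⊛ fd)) equation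
        equationZ = rotate (gn ⊛ σ gd ⊛ fd) (‹ - κ › ⊛ (σ gn ⊛ gd ⊛ fd)) (fn ⊛ (σ gd ⊛ gd)) equationY

      -- The lowest multiplicity has to occur twice; when the summand of f does not attain it, those
      -- of g and σ(g) must tie.
      Y≡Z : Y ℕ.< X ⊎ Z ℕ.< X → Y ≡ Z
      Y≡Z lt with ℕ.<-cmp Y Z | lt
      ... | tri≈ _ e _ | _ = e
      ... | tri< Y<Z _ _ | inj₁ Y<X = ⊥-elim (not-lowest α≉0 factorY factorZ factorX equationY Y<Z Y<X)
      ... | tri< Y<Z _ _ | inj₂ Z<X =
        ⊥-elim (not-lowest α≉0 factorY factorZ factorX equationY Y<Z (ℕ.<-trans Y<Z Z<X))
      ... | tri> _ _ Z<Y | inj₁ Y<X =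
        ⊥-elim (not-lowest α≉0 factorZ factorX factorY equationZ (ℕ.<-trans Z<Y Y<X) Z<Y)
      ... | tri> _ _ Z<Y | inj₂ Z<X = ⊥-elim (not-lowest α≉0 factorZ factorX factorY equationZ Z<X Z<Y)

      X≡Z : X ℕ.< Y → X ≡ Z
      X≡Z X<Y with ℕ.<-cmp X Z
      ... | tri≈ _ e _ = e
      ... | tri< X<Z _ _ = ⊥-elim (not-lowest α≉0 factorX factorY factorZ equation X<Y X<Z)
      ... | tri> _ _ Z<X = ⊥-elim (not-lowest α≉0 factorZ factorX factorY equationZ Z<X (ℕ.<-trans Z<X X<Y))

      module _ (t≤s : t ℕ.≤ s) where
        -- `t ≤ s` says that f is regular at α. Hence a pole of g at α, or of σ(g) at α (that is, of
        -- g at γ), puts its summand strictly below that of f.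
        below : a ℕ.< b ⊎ a′ ℕ.< b′ → Y ℕ.< X ⊎ Z ℕ.< X
        below (inj₁ a<b) = inj₁ (≡.subst (ℕ._< X) (eq t b′ a)
          (ℕ.+-mono-≤-< t≤s (ℕ.+-monoʳ-< b′ a<b)))
          where
          eq : ∀ t b a → t ℕ.+ (b ℕ.+ a) ≡ a ℕ.+ b ℕ.+ t
          eq = ℕ.solve-∀
        below (inj₂ a′<b′) = inj₂ (≡.subst (ℕ._< X) (ℕ.+-comm t (a′ ℕ.+ b))
          (ℕ.+-mono-≤-< t≤s (ℕ.+-monoˡ-< b a′<b′)))

        -- Free of subtraction, this is b - a = b′ - a′: g has the same order at α and at γ.
        orders-agree : a ℕ.< b ⊎ a′ ℕ.< b′ → a ℕ.+ b′ ≡ a′ ℕ.+ b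
        orders-agree lt = ℕ.+-cancelʳ-≡ t _ _ (Y≡Z (below lt))

        values-agree : a ℕ.< b → ⟦ u ⟧ α * ⟦ V ⟧ α ≈ κ * (⟦ U ⟧ α * ⟦ v ⟧ α)
        values-agree a<b = *-cancelˡ (value≉0 fdF) (x∙y⁻¹≈ε⇒x≈y _ _ (begin
          ⟦ z ⟧ α * (⟦ u ⟧ α * ⟦ V ⟧ α) - ⟦ z ⟧ α * (κ * (⟦ U ⟧ α * ⟦ v ⟧ α))
            ≈⟨ +-congˡ (trans (-‿distribʳ-* (⟦ z ⟧ α) _) (*-congˡ (-‿distribˡ-* κ _))) ⟩
          ⟦ z ⟧ α * (⟦ u ⟧ α * ⟦ V ⟧ α) + ⟦ z ⟧ α * (- κ * (⟦ U ⟧ α * ⟦ v ⟧ α))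
            ≈⟨ solve 6 (λ z u V k U v → z :* (u :* V) :+ z :* (k :* (U :* v)) := u :* V :* z :+ k :* (U :* v :* z)) refl _ _ _ (- κ) _ _ ⟩
          ⟦ u ⟧ α * ⟦ V ⟧ α * ⟦ z ⟧ α + - κ * (⟦ U ⟧ α * ⟦ v ⟧ α * ⟦ z ⟧ α)
            ≈⟨ +-cong (trans (eval-⊛ (u ⊛ V) z α) (*-congʳ (eval-⊛ u V α)))
                 (trans (eval-⊛ ‹ - κ › (U ⊛ v ⊛ z) α) (*-cong (eval-const (- κ) α)
                   (trans (eval-⊛ (U ⊛ v) z α) (*-congʳ (eval-⊛ U v α))))) ⟨
          ⟦ u ⊛ V ⊛ z ⟧ α + ⟦ ‹ - κ › ⊛ (U ⊛ v ⊛ z) ⟧ α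
            ≈⟨ lowest-pair α≉0 factorX factorY factorZ′ equation Y<X ⟩
          0# ∎))
          where
          open ≈-Reasoning
          factorZ′ = ≡.subst (λ n → Factor (‹ - κ › ⊛ (σ gn ⊛ gd ⊛ fd)) α n (‹ - κ › ⊛ (U ⊛ v ⊛ z)))
                       (≡.sym (Y≡Z (below (inj₁ a<b)))) factorZ
          Y<X : Y ℕ.< X
          Y<X with below (inj₁ a<b)
          ... | inj₁ lt = lt
          ... | inj₂ lt = ≡.subst (ℕ._< X) (≡.sym (Y≡Z (inj₂ lt))) lt

        order-preserved : ∀ n → 0 ℕ.< n → b ≡ n ℕ.+ a → b′ ≡ n ℕ.+ a′
        order-preserved n 0<n e = ℕ.+-cancelˡ-≡ a _ _ (≡.trans (orders-agree (inj₁ a<b))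
          (≡.trans (≡.cong (a′ ℕ.+_) e) (eq a′ n a)))
          where
          a<b : a ℕ.< b
          a<b = ≡.subst (a ℕ.<_) (≡.sym e) (ℕ.m<n+m a 0<n)
          eq : ∀ x n a → x ℕ.+ (n ℕ.+ a) ≡ a ℕ.+ (n ℕ.+ x)
          eq = ℕ.solve-∀

        -- `values-agree` carries the slope to the power b′ on one side and a′ on the other, an
        -- excess of n. The factor α^n turns slope^n into (p γ)^n, so that relations along an orbit
        -- can be multiplied together.
        leading-coefficients : ∀ n → 0 ℕ.< n → b ≡ n ℕ.+ a →
          ⟦ u ⟧ α * ⟦ v′ ⟧ γ * (pK ^ n * γ ^ n) ≈ κ * (⟦ u′ ⟧ γ * ⟦ v ⟧ α) * α ^ n
        leading-coefficients n 0<n e = *-cancelˡ (^-≉0 a′ (slope≉0 α≉0)) (begin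
          H ^ a′ * (⟦ u ⟧ α * ⟦ v′ ⟧ γ * (pK ^ n * γ ^ n))
            ≈⟨ *-congˡ (*-congˡ (trans (sym (*-^ pK γ n)) (trans (^-cong n (sym (slope-eq γ≈αᵖ))) (*-^ H α n)))) ⟩
          H ^ a′ * (⟦ u ⟧ α * ⟦ v′ ⟧ γ * (H ^ n * α ^ n))
            ≈⟨ solve 5 (λ h u v k x → h :* (u :* v :* (k :* x)) := u :* (k :* h :* v) :* x) refl _ _ _ _ _ ⟩
          ⟦ u ⟧ α * (H ^ n * H ^ a′ * ⟦ v′ ⟧ γ) * α ^ n
            ≈⟨ *-congʳ (*-congˡ (*-congʳ (trans (^-≡ H (order-preserved n 0<n e)) (^-+ H n a′)))) ⟨
          ⟦ u ⟧ α * (H ^ b′ * ⟦ v′ ⟧ γ) * α ^ n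
            ≈⟨ *-congʳ (*-congˡ (eval-σ-unit b′ v′ γ≈αᵖ)) ⟨
          ⟦ u ⟧ α * ⟦ V ⟧ α * α ^ n
            ≈⟨ *-congʳ (values-agree (≡.subst (a ℕ.<_) (≡.sym e) (ℕ.m<n+m a 0<n))) ⟩
          κ * (⟦ U ⟧ α * ⟦ v ⟧ α) * α ^ n
            ≈⟨ *-congʳ (*-congˡ (*-congʳ (eval-σ-unit a′ u′ γ≈αᵖ))) ⟩
          κ * (H ^ a′ * ⟦ u′ ⟧ γ * ⟦ v ⟧ α) * α ^ n
            ≈⟨ solve 5 (λ k h u v x → k :* (h :* u :* v) :* x := h :* (k :* (u :* v) :* x)) refl _ _ _ _ _ ⟩
          H ^ a′ * (κ * (⟦ u′ ⟧ γ * ⟦ v ⟧ α) * α ^ n) ∎)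
          where
          H = slope α
          open ≈-Reasoning

      -- With g regular at α, the pole of f there can only come from σ(g), whose order at α is that
      -- of g at γ.
      pole-transfer : ∀ k → 0 ℕ.< k → t ≡ k ℕ.+ s → b ℕ.≤ a → b′ ≡ k ℕ.+ a′
      pole-transfer k 0<k e b≤a = ℕ.+-cancelʳ-≡ (s ℕ.+ b) _ _
        (≡.trans (eq₁ b′ s b) (≡.trans (X≡Z X<Y) (≡.trans (≡.cong (a′ ℕ.+ b ℕ.+_) e) (eq₂ a′ b k s))))
        where
        eq₁ : ∀ b′ s b → b′ ℕ.+ (s ℕ.+ b) ≡ s ℕ.+ (b′ ℕ.+ b)
        eq₁ = ℕ.solve-∀
        eq₂ : ∀ a′ b k s → a′ ℕ.+ b ℕ.+ (k ℕ.+ s) ≡ k ℕ.+ a′ ℕ.+ (s ℕ.+ b)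
        eq₂ = ℕ.solve-∀
        eq₃ : ∀ t b a → t ℕ.+ (b ℕ.+ a) ≡ a ℕ.+ b ℕ.+ t
        eq₃ = ℕ.solve-∀
        X<Y : X ℕ.< Y
        X<Y = ≡.subst (X ℕ.<_) (eq₃ t b′ a)
          (ℕ.+-mono-<-≤ (≡.subst (s ℕ.<_) (≡.sym e) (ℕ.m<n+m s 0<k)) (ℕ.+-monoʳ-≤ b′ b≤a))

-- Poles along the orbits of a dispersionless tree

module Orbits {c ℓ : Level} (K : ACField c ℓ) (q : ℕ) (f g : RatFun K) (κ : ACField.Carrier K) where
  open ACField K
  open Polynomials K
  open Field K
  open LocalFactors K
  open Spread K q hiding (p; pK)
  open Mahler K (suc q)
  open NaturalSolver commutativeSemiring
    using (solve; _:=_; _:+_; _:*_; con)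
  open Poles K q f g κ

  ^-pow-+ : ∀ x i j → (x ^ (p ℕ.^ i)) ^ (p ℕ.^ j) ≈ x ^ (p ℕ.^ (i ℕ.+ j))
  ^-pow-+ x i j = trans (^-* x (p ℕ.^ i) (p ℕ.^ j)) (^-≡ x (≡.sym (ℕ.^-distribˡ-+-* p i j)))

  ^-pow-1 : ∀ x → x ^ (p ℕ.^ 1) ≈ x ^ p
  ^-pow-1 x = ^-≡ x (ℕ.*-identityʳ p)

  InTree-forward : ∀ {β α} k → InTree β α → InTree β (α ^ (p ℕ.^ k))
  InTree-forward {β} {α} k (α≉0 , r , s , e) = ^-≉0 (p ℕ.^ k) α≉0 , r , s ℕ.+ k , (begin
    (α ^ (p ℕ.^ k)) ^ (p ℕ.^ r)   ≈⟨ ^-comm α (p ℕ.^ k) (p ℕ.^ r) ⟩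
    (α ^ (p ℕ.^ r)) ^ (p ℕ.^ k)   ≈⟨ ^-cong (p ℕ.^ k) e ⟩
    (β ^ (p ℕ.^ s)) ^ (p ℕ.^ k)   ≈⟨ ^-pow-+ β s k ⟩
    β ^ (p ℕ.^ (s ℕ.+ k))         ∎)
    where open ≈-Reasoning

  InTree-backward : ∀ {β α α′} k → α′ ≉ 0# → α′ ^ (p ℕ.^ k) ≈ α → InTree β α → InTree β α′
  InTree-backward {β} {α} {α′} k α′≉0 e (_ , r , s , e′) = α′≉0 , k ℕ.+ r , s ,
    trans (sym (^-pow-+ α′ k r)) (trans (^-cong (p ℕ.^ r) e) e′)

  module Propagation
    (κ≉0 : κ ≉ 0#)
    (summable : (fn ⊛ (σ gd ⊛ gd)) ≋ ((κ ⊙ (σ gn ⊛ gd)) ⊕ ⊖ (gn ⊛ σ gd)) ⊛ fd)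
    (fn≉0 : ¬ (fn ≋ [])) (fd≉0 : ¬ (fd ≋ [])) (gd≉0 : ¬ (gd ≋ []))
    where
    open Equation κ≉0 summable fn≉0 fd≉0 gd≉0
    open Germ

    gGerm : ∀ {α} → α ≉ 0# → ¬ ¬ Germ gn gd α
    gGerm {α} α≉0 = germ-exists α (gn≉0 α≉0) gd≉0

    fGerm : ∀ {α} → ¬ ¬ Germ fn fd α
    fGerm {α} = germ-exists α fn≉0 fd≉0

    -- With c = u / v the leading coefficient of g, the equation says that c / α ^ n is multiplied by (p ^ n / κ) ^ e on
    -- the way from α to γ = α ^ p ^ e.
    Transported : ∀ {α γ} → ℕ → ℕ → Germ gn gd α → Germ gn gd γ → Set ℓ
    Transported {α} {γ} n e G G′ =
      b G′ ≡ n ℕ.+ a G′ ×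
      ⟦ u G ⟧ α * ⟦ v G′ ⟧ γ * ((pK ^ n) ^ e * γ ^ n) ≈ κ ^ e * (⟦ u G′ ⟧ γ * ⟦ v G ⟧ α) * α ^ n

    RegularBelow : ℕ → Carrier → Set (c ⊔ ℓ)
    RegularBelow e α = ∀ k → k ℕ.< e → ¬ IsPole f (α ^ (p ℕ.^ k))

    transport-step : ∀ {α γ} n → 0 ℕ.< n → α ≉ 0# → γ ≈ α ^ p → ¬ IsPole f α →
                     (G : Germ gn gd α) (G′ : Germ gn gd γ) → b G ≡ n ℕ.+ a G → ¬ ¬ Transported n 1 G G′
    transport-step {α} {γ} n 0<n α≉0 e regular G G′ order k = fGerm λ F →
      let open At α≉0 e F G G′ using (order-preserved; leading-coefficients)
          t≤s = regular⇒≤ α≉0 regular F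
      in k ( order-preserved t≤s n 0<n order
           , trans (*-congˡ (*-congʳ (*-identityʳ (pK ^ n))))
               (trans (leading-coefficients t≤s n 0<n order) (*-congʳ (*-congʳ (sym (*-identityʳ κ))))))

    transport : ∀ e {α γ} n → 0 ℕ.< n → α ≉ 0# → γ ≈ α ^ (p ℕ.^ suc e) → RegularBelow (suc e) α →
                (G : Germ gn gd α) (G′ : Germ gn gd γ) → b G ≡ n ℕ.+ a G → ¬ ¬ Transported n (suc e) G G′
    transport zero {α} n 0<n α≉0 e regular G G′ order =
      transport-step n 0<n α≉0 (trans e (^-pow-1 α))
        -- `RegularBelow` at k = 0 speaks of `α ^ (p ℕ.^ 0)`, which is `α * 1#` and not α itself.
        (λ pole → regular 0 (s≤s z≤n) (IsPole-cong (^-≉0 (p ℕ.^ 0) α≉0) (sym (*-identityʳ α)) pole)) G G′ order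
    transport (suc i) {α} {γ} n 0<n α≉0 e regular G G′ order k = gGerm β≉0 λ M →
      transport-step n 0<n α≉0 refl
        (λ pole → regular 0 (s≤s z≤n) (IsPole-cong (^-≉0 (p ℕ.^ 0) α≉0) (sym (*-identityʳ α)) pole)) G M order
        λ (orderM , eqM) →
      transport i {β} {γ} n 0<n β≉0 (trans e (sym (^-* α p (p ℕ.^ suc i))))
        (λ j j<e pole → regular (suc j) (s≤s j<e)
          (IsPole-cong (^-≉0 (p ℕ.^ suc j) α≉0) (^-* α p (p ℕ.^ j)) pole)) M G′ orderM
        -- In the product of the two relations the data of the intermediate germ `M` at β appear on
        -- both sides and form the nonzero factor that is cancelled.
        λ (order′ , eq′) → k (order′ , *-cancelˡ (*-≉0 (*-≉0 (value≉0 (denom M)) (value≉0 (numer M))) (^-≉0 n β≉0)) (begin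
          ⟦ v M ⟧ β * ⟦ u M ⟧ β * β ^ n * (⟦ u G ⟧ α * ⟦ v G′ ⟧ γ * (pK ^ n * (pK ^ n) ^ suc i * γ ^ n))
            ≈⟨ solve 8 (λ vm um b u v′ h hi c →
                 vm :* um :* b :* (u :* v′ :* (h :* hi :* c)) := u :* vm :* (h :* b) :* (um :* v′ :* (hi :* c)))
                 refl _ _ _ _ _ _ _ _ ⟩
          ⟦ u G ⟧ α * ⟦ v M ⟧ β * (pK ^ n * β ^ n) * (⟦ u M ⟧ β * ⟦ v G′ ⟧ γ * ((pK ^ n) ^ suc i * γ ^ n))
            ≈⟨ *-cong (trans (*-congˡ (*-congʳ (sym (*-identityʳ (pK ^ n))))) eqM) eq′ ⟩
          κ * 1# * (⟦ u M ⟧ β * ⟦ v G ⟧ α) * α ^ n * (κ ^ suc i * (⟦ u G′ ⟧ γ * ⟦ v M ⟧ β) * β ^ n)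
            ≈⟨ solve 8 (λ k um v x ki u′ vm b →
                 k :* con 1 :* (um :* v) :* x :* (ki :* (u′ :* vm) :* b) := vm :* um :* b :* (k :* ki :* (u′ :* v) :* x))
                 refl _ _ _ _ _ _ _ _ ⟩
          ⟦ v M ⟧ β * ⟦ u M ⟧ β * β ^ n * (κ * κ ^ suc i * (⟦ u G′ ⟧ γ * ⟦ v G ⟧ α) * α ^ n) ∎))
      where
      β = α ^ p
      β≉0 = ^-≉0 p α≉0
      open ≈-Reasoning

    module Dispersionless {tree : Carrier} (no-disp : ∀ d → 0 ℕ.< d → ¬ DispWitnessTree f tree d)
                          {δ : Carrier} {n : ℕ} (δ∈tree : InTree tree δ) (pole : PoleOfOrder f δ n) where
      δ≉0 : δ ≉ 0#
      δ≉0 = proj₁ δ∈tree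

      0<n : 0 ℕ.< n
      0<n = proj₁ pole

      regular-after : ∀ k → 0 ℕ.< k → ¬ IsPole f (δ ^ (p ℕ.^ k))
      regular-after k 0<k pole′ =
        no-disp k 0<k (δ , (δ∈tree , n , pole) , (InTree-forward k δ∈tree , pole′))

      regular-before : ∀ k {α} → 0 ℕ.< k → α ≉ 0# → α ^ (p ℕ.^ k) ≈ δ → ¬ IsPole f α
      regular-before k {α} 0<k α≉0 e pole′ = no-disp k 0<k
        (α , (InTree-backward k α≉0 e δ∈tree , pole′)
           , (InTree-forward k (InTree-backward k α≉0 e δ∈tree)
             , IsPole-cong (^-≉0 (p ℕ.^ k) α≉0) (sym e) (n , pole)))

      ancestor : ℕ → Carrier
      ancestor zero    = δ
      ancestor (suc k) = proj₁ (root (ancestor k))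

      ancestor-^p : ∀ k → ancestor (suc k) ^ p ≈ ancestor k
      ancestor-^p k = proj₂ (root (ancestor k))

      ancestor-^ : ∀ j k → ancestor (j ℕ.+ k) ^ (p ℕ.^ j) ≈ ancestor k
      ancestor-^ zero    k = *-identityʳ (ancestor k)
      ancestor-^ (suc j) k = trans (sym (^-* (ancestor (suc (j ℕ.+ k))) p (p ℕ.^ j)))
        (trans (^-cong (p ℕ.^ j) (ancestor-^p (j ℕ.+ k))) (ancestor-^ j k))

      ancestor-^δ : ∀ j → ancestor j ^ (p ℕ.^ j) ≈ δ
      ancestor-^δ j = ≡.subst (λ i → ancestor i ^ (p ℕ.^ j) ≈ δ) (ℕ.+-identityʳ j) (ancestor-^ j 0)

      ancestor≉0 : ∀ k → ancestor k ≉ 0#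
      ancestor≉0 zero    e = δ≉0 e
      ancestor≉0 (suc k) e = ancestor≉0 k
        (trans (sym (ancestor-^p k)) (trans (*-congʳ e) (zeroˡ _)))

      -- A coincidence makes x = `ancestor j` periodic, and with it δ, which is a power of x. Then δ
      -- recurs as a pole at a positive distance from itself, a dispersion witness.
      ancestors-distinct : ∀ i j → i ℕ.< j → ancestor i ≉ ancestor j
      ancestors-distinct i j i<j e with ℕ.m≤n⇒∃[o]m+o≡n i<j
      ... | d , ≡.refl = regular-after (suc d) (s≤s z≤n)
        (IsPole-cong (^-≉0 (p ℕ.^ suc d) δ≉0) (sym δ-periodic) (n , pole))
        where
        x = ancestor (suc i ℕ.+ d)
        x-periodic : x ^ (p ℕ.^ suc d) ≈ x
        x-periodic = trans (≡.subst (λ k → ancestor k ^ (p ℕ.^ suc d) ≈ ancestor i)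
          (≡.cong suc (ℕ.+-comm d i)) (ancestor-^ (suc d) i)) e
        δ-periodic : δ ^ (p ℕ.^ suc d) ≈ δ
        δ-periodic = begin
          δ ^ (p ℕ.^ suc d)                               ≈⟨ ^-cong (p ℕ.^ suc d) (ancestor-^δ (suc i ℕ.+ d)) ⟨
          (x ^ (p ℕ.^ (suc i ℕ.+ d))) ^ (p ℕ.^ suc d)     ≈⟨ ^-comm x (p ℕ.^ (suc i ℕ.+ d)) (p ℕ.^ suc d) ⟩
          (x ^ (p ℕ.^ suc d)) ^ (p ℕ.^ (suc i ℕ.+ d))     ≈⟨ ^-cong (p ℕ.^ (suc i ℕ.+ d)) x-periodic ⟩
          x ^ (p ℕ.^ (suc i ℕ.+ d))                       ≈⟨ ancestor-^δ (suc i ℕ.+ d) ⟩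
          δ ∎
          where open ≈-Reasoning

      g-regular-at-δ : (G : Germ gn gd δ) → ¬ (a G ℕ.< b G)
      g-regular-at-δ G a<b = many-roots _ gd ℕ.≤-refl ancestor ancestors-distinct
        (λ i h → ancestor-pole i λ (G , a<b) → h (factor-root (ℕ.≤-<-trans z≤n a<b) (denom G))) gd≉0
        where
        ancestor-pole : ∀ i → ¬ ¬ (∃ λ (G : Germ gn gd (ancestor i)) → a G ℕ.< b G)
        ancestor-pole zero    h = h (G , a<b)
        ancestor-pole (suc i) h = ancestor-pole i λ (G′ , a<b′) →
          fGerm λ F → gGerm (ancestor≉0 (suc i)) λ G →
          let open At (ancestor≉0 (suc i)) (sym (ancestor-^p i)) F G G′ using (orders-agree)
              same = orders-agree
                (regular⇒≤ (ancestor≉0 (suc i)) (regular-before (suc i) (s≤s z≤n) (ancestor≉0 (suc i)) (ancestor-^δ (suc i))) F)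
                (inj₂ a<b′)
          -- From a + b′ = a′ + b and a′ < b′ follows a < b.
          in h (G , ℕ.+-cancelˡ-< (a G′) _ _ (≡.subst₂ ℕ._<_ (ℕ.+-comm (a G) (a G′)) same
                 (ℕ.+-monoʳ-< (a G) a<b′)))

      -- Counting starts at δ^p, the first point of the forward orbit where g has a pole while f is
      -- regular.
      descendant : ℕ → Carrier
      descendant k = δ ^ (p ℕ.^ suc k)

      descendant≉0 : ∀ k → descendant k ≉ 0#
      descendant≉0 k = ^-≉0 (p ℕ.^ suc k) δ≉0

      descendant-^ : ∀ i d → descendant (i ℕ.+ d) ≈ descendant i ^ (p ℕ.^ d)
      descendant-^ i d = sym (^-pow-+ δ (suc i) d)

      descendant-regular : ∀ i e → RegularBelow e (descendant i)
      descendant-regular i e k _ pole′ = regular-after (suc i ℕ.+ k) (s≤s z≤n)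
        (IsPole-cong (descendant≉0 (i ℕ.+ k)) (sym (descendant-^ i k)) pole′)

      descendant-order : ∀ k (G : Germ gn gd (descendant k)) → ¬ ¬ (b G ≡ n ℕ.+ a G)
      descendant-order zero G′ h = gGerm δ≉0 λ G →
        let (F , t≡n+s) = pole⇒germ pole
            open At δ≉0 (^-pow-1 δ) F G G′ using (pole-transfer)
        in h (pole-transfer n 0<n t≡n+s (ℕ.≮⇒≥ (g-regular-at-δ G)))
      descendant-order (suc k) G′ h = gGerm (descendant≉0 0) λ G → descendant-order 0 G λ order →
        transport k n 0<n (descendant≉0 0) (descendant-^ 0 (suc k)) (descendant-regular 0 (suc k)) G G′ order
          λ (order′ , _) → h order′

      Cycle : Set (c ⊔ ℓ)
      Cycle = ∃ λ ζ → ∃ λ e → InTree tree ζ × ζ ^ (p ℕ.^ suc e) ≈ ζ × (pK ^ n) ^ suc e ≈ κ ^ suc e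

      -- The pigeonhole principle in contrapositive form: without a `Cycle` no two descendants could
      -- coincide, and infinitely many distinct points would be roots of `gd`.
      cycle : ¬ ¬ Cycle
      cycle h = many-roots _ gd ℕ.≤-refl descendant distinct
        (λ i r → gGerm (descendant≉0 i) λ G → descendant-order i G λ order →
          r (factor-root (≡.subst (0 ℕ.<_) (≡.sym order) (ℕ.<-≤-trans 0<n (ℕ.m≤m+n n (a G)))) (denom G))) gd≉0
        where
        distinct : ∀ i j → i ℕ.< j → descendant i ≉ descendant j
        distinct i j i<j e with ℕ.m≤n⇒∃[o]m+o≡n i<j
        ... | d , ≡.refl = gGerm (descendant≉0 i) λ G → descendant-order i G λ order →
          -- Both ends of the transport carry the same germ, moved along e, so u and v agree at the
          -- ends and only the two constants remain.
          transport d n 0<n (descendant≉0 i) ζ-step (descendant-regular i (suc d)) G (germ-cong e G) order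
            λ (_ , eq) → h (ζ , d , InTree-forward (suc i) δ∈tree , sym (trans e ζ-step) ,
              *-cancelˡ (*-≉0 (*-≉0 (value≉0 (numer G)) (value≉0 (denom G))) (^-≉0 n (descendant≉0 i))) (begin
                ⟦ u G ⟧ ζ * ⟦ v G ⟧ ζ * ζ ^ n * (pK ^ n) ^ suc d
                  ≈⟨ solve 4 (λ u v x k → u :* v :* x :* k := u :* v :* (k :* x)) refl _ _ _ _ ⟩
                ⟦ u G ⟧ ζ * ⟦ v G ⟧ ζ * ((pK ^ n) ^ suc d * ζ ^ n)
                  ≈⟨ *-cong (*-congˡ (eval-cong (v G) (v G) P.refl e)) (*-congˡ (^-cong n e)) ⟩
                ⟦ u G ⟧ ζ * ⟦ v G ⟧ ζ′ * ((pK ^ n) ^ suc d * ζ′ ^ n)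
                  ≈⟨ eq ⟩
                κ ^ suc d * (⟦ u G ⟧ ζ′ * ⟦ v G ⟧ ζ) * ζ ^ n
                  ≈⟨ *-congʳ (*-congˡ (*-congʳ (eval-cong (u G) (u G) P.refl e))) ⟨
                κ ^ suc d * (⟦ u G ⟧ ζ * ⟦ v G ⟧ ζ) * ζ ^ n
                  ≈⟨ solve 4 (λ u v x k → k :* (u :* v) :* x := u :* v :* x :* k) refl _ _ _ _ ⟩
                ⟦ u G ⟧ ζ * ⟦ v G ⟧ ζ * ζ ^ n * κ ^ suc d ∎))
          where
          ζ = descendant i
          ζ′ = descendant (suc i ℕ.+ d)
          ζ-step : ζ′ ≈ ζ ^ (p ℕ.^ suc d)
          ζ-step = trans (^-≡ δ (≡.cong (λ k → p ℕ.^ suc k) (≡.sym (ℕ.+-suc i d)))) (descendant-^ i (suc d))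
          open ≈-Reasoning

-- Degrees, division with remainder, and coefficients of negative powers

module Degrees {c ℓ : Level} (K : ACField c ℓ) (q : ℕ) where
  open ACField K
  open Polynomials K
  open Field K
  open LocalFactors K
  open Spread K q
  open import Algebra.Properties.Ring ring
  open NaturalSolver commutativeSemiring
    using (solve; _:=_; _:+_; _:*_; con)

  coeff-shift : ∀ k P j → shift k P [ k ℕ.+ j ] ≈ P [ j ]
  coeff-shift zero    P j = refl
  coeff-shift (suc k) P j = coeff-shift k P j

  coeff-shift-< : ∀ k P j → j ℕ.< k → shift k P [ j ] ≈ 0#
  coeff-shift-< (suc k) P zero    _         = refl
  coeff-shift-< (suc k) P (suc j) (s≤s j<k) = coeff-shift-< k P j j<k

  coeff-σ-multiple : ∀ P j → σ P [ j ℕ.* p ] ≈ P [ j ]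
  coeff-σ-multiple []      j       = refl
  coeff-σ-multiple (a ∷ P) zero    = refl
  coeff-σ-multiple (a ∷ P) (suc j) = trans (coeff-shift q (σ P) (j ℕ.* p)) (coeff-σ-multiple P j)

  coeff-σ-other : ∀ P i → ¬ (p ∣ i) → σ P [ i ] ≈ 0#
  coeff-σ-other []      i       _   = refl
  coeff-σ-other (a ∷ P) zero    p∤i = ⊥-elim (p∤i (p ∣0))
  coeff-σ-other (a ∷ P) (suc i) p∤i with i ℕ.<? q
  ... | yes i<q = coeff-shift-< q (σ P) i i<q
  ... | no  i≮q with ℕ.m≤n⇒∃[o]m+o≡n (ℕ.≮⇒≥ i≮q)
  ...   | k , ≡.refl = trans (coeff-shift q (σ P) k)
          (coeff-σ-other P k λ p∣k → p∤i (∣m∣n⇒∣m+n ∣-refl p∣k))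

  DegreeBelow : Poly K → ℕ → Set ℓ
  DegreeBelow P d = ∀ j → d ℕ.≤ j → P [ j ] ≈ 0#

  Degree : Poly K → ℕ → Set ℓ
  Degree P d = P [ d ] ≉ 0# × DegreeBelow P (suc d)

  degreeBelow-≋ : ∀ {P Q d} → P ≋ Q → DegreeBelow P d → DegreeBelow Q d
  degreeBelow-≋ e h j d≤j = trans (sym (at e j)) (h j d≤j)

  degreeBelow-⊕ : ∀ {P Q d} → DegreeBelow P d → DegreeBelow Q d → DegreeBelow (P ⊕ Q) d
  degreeBelow-⊕ {P} {Q} h k j d≤j =
    trans (coeff-⊕ P Q j) (trans (+-cong (h j d≤j) (k j d≤j)) (+-identityʳ 0#))

  degreeBelow-⊖ : ∀ {P d} → DegreeBelow P d → DegreeBelow (⊖ P) d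
  degreeBelow-⊖ {P} h j d≤j = trans (coeff-⊖ P j) (trans (-‿cong (h j d≤j)) -0#≈0#)

  degreeBelow-⊙ : ∀ {P d} a → DegreeBelow P d → DegreeBelow (a ⊙ P) d
  degreeBelow-⊙ {P} a h j d≤j = trans (coeff-⊙ a P j) (trans (*-congˡ (h j d≤j)) (zeroʳ a))

  -- A strict bound on P and a non-strict one on Q add up without correction; the numerator of a
  -- proper fraction takes the strict side.
  degreeBelow-⊛ : ∀ {P Q d e} → DegreeBelow P d → DegreeBelow Q (suc e) → DegreeBelow (P ⊛ Q) (d ℕ.+ e)
  degreeBelow-⊛ {[]}    {Q}             h k j       _        = refl
  degreeBelow-⊛ {a ∷ P} {Q} {zero}      h k j       _        =
    at (≋[]-⊛ {a ∷ P} Q (mk≋ λ i → h i z≤n)) j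
  degreeBelow-⊛ {a ∷ P} {Q} {suc d} {e} h k (suc j) (s≤s le) = begin
    (a ⊙ Q ⊕ (0# ∷ P ⊛ Q)) [ suc j ]   ≈⟨ coeff-⊕ (a ⊙ Q) (0# ∷ P ⊛ Q) (suc j) ⟩
    (a ⊙ Q) [ suc j ] + (P ⊛ Q) [ j ]
      ≈⟨ +-cong (degreeBelow-⊙ {Q} a k (suc j) (s≤s (ℕ.≤-trans (ℕ.m≤n+m e d) le)))
           (degreeBelow-⊛ {P} {Q} {d} {e} (λ i d≤i → h (suc i) (s≤s d≤i)) k j le) ⟩
    0# + 0#                            ≈⟨ +-identityʳ 0# ⟩
    0#                                 ∎
    where open ≈-Reasoning

  leading-⊛ : ∀ {P Q d e} → DegreeBelow P (suc d) → DegreeBelow Q (suc e) → (P ⊛ Q) [ d ℕ.+ e ] ≈ P [ d ] * Q [ e ]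
  leading-⊛ {[]}    {Q}             h k = sym (zeroˡ _)
  leading-⊛ {a ∷ P} {Q} {zero}  {e} h k = begin
    (a ⊙ Q ⊕ (0# ∷ P ⊛ Q)) [ e ]   ≈⟨ at (P.+-congˡ {a ⊙ Q} (∷≋[] refl (≋[]-⊛ {P} Q (mk≋ λ i → h (suc i) (s≤s z≤n))))) e ⟩
    (a ⊙ Q ⊕ []) [ e ]             ≈⟨ at (⊕-identityʳ (a ⊙ Q)) e ⟩
    (a ⊙ Q) [ e ]                  ≈⟨ coeff-⊙ a Q e ⟩
    a * Q [ e ]                    ∎
    where open ≈-Reasoning
  leading-⊛ {a ∷ P} {Q} {suc d} {e} h k = begin
    (a ⊙ Q ⊕ (0# ∷ P ⊛ Q)) [ suc (d ℕ.+ e) ]     ≈⟨ coeff-⊕ (a ⊙ Q) (0# ∷ P ⊛ Q) (suc (d ℕ.+ e)) ⟩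
    (a ⊙ Q) [ suc (d ℕ.+ e) ] + (P ⊛ Q) [ d ℕ.+ e ]
      ≈⟨ +-cong (degreeBelow-⊙ {Q} a k _ (s≤s (ℕ.m≤n+m e d)))
           (leading-⊛ {P} {Q} {d} {e} (λ i d<i → h (suc i) (s≤s d<i)) k) ⟩
    0# + P [ d ] * Q [ e ]                       ≈⟨ +-identityˡ _ ⟩
    P [ d ] * Q [ e ]                            ∎
    where open ≈-Reasoning

  degree-⊛ : ∀ {P Q d e} → Degree P d → Degree Q e → Degree (P ⊛ Q) (d ℕ.+ e)
  degree-⊛ {P} {Q} (x , h) (y , k) =
    (λ z → *-≉0 x y (trans (sym (leading-⊛ {P} {Q} h k)) z)) , degreeBelow-⊛ {P} {Q} h k

  degreeBelow-σ : ∀ {P d} → DegreeBelow P d → DegreeBelow (σ P) (d ℕ.* p)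
  degreeBelow-σ {P} {d} h j le with p ∣? j
  ... | no  p∤j = coeff-σ-other P j p∤j
  ... | yes (divides k ≡.refl) = trans (coeff-σ-multiple P k) (h k (ℕ.*-cancelʳ-≤ d k p le))

  degree-σ : ∀ {P d} → Degree P d → Degree (σ P) (d ℕ.* p)
  degree-σ {P} {d} (x , h) = (λ z → x (trans (sym (coeff-σ-multiple P d)) z)) , below
    where
    below : DegreeBelow (σ P) (suc (d ℕ.* p))
    below j lt with p ∣? j
    ... | no  p∤j = coeff-σ-other P j p∤j
    ... | yes (divides k ≡.refl) = trans (coeff-σ-multiple P k) (h k (ℕ.*-cancelʳ-< p d k lt))

  zero-or-degree : ∀ P → ¬ ¬ (P ≋ [] ⊎ ∃ (Degree P))
  zero-or-degree []      h = h (inj₁ P.refl)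
  zero-or-degree (a ∷ P) h = zero-or-degree P λ where
    (inj₂ (d , x , k)) → h (inj₂ (suc d , x , λ { (suc j) (s≤s le) → k j le }))
    (inj₁ P≋[])        → ¬¬-excluded-middle λ where
      (yes a≈0) → h (inj₁ (∷≋[] a≈0 P≋[]))
      (no  a≉0) → h (inj₂ (0 , a≉0 , λ { (suc j) _ → at P≋[] j }))

  -- If Q had degree e ≥ k, the coefficient of the product at d + e would be a product of two
  -- nonzero leading coefficients. The `κ` here is the continuation, not the scalar.
  degreeBelow-cofactor : ∀ {P Q d k} → Degree P d → DegreeBelow (P ⊛ Q) (d ℕ.+ k) → ¬ ¬ DegreeBelow Q k
  degreeBelow-cofactor {P} {Q} {d} {k} (x , h) b κ = zero-or-degree Q λ where
      (inj₁ Q≋[])        → κ λ j _ → at Q≋[] j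
      (inj₂ (e , y , l)) → case-≤ e y l (e ℕ.<? k)
    where
    case-≤ : ∀ e → Q [ e ] ≉ 0# → DegreeBelow Q (suc e) → Dec (e ℕ.< k) → ⊥
    case-≤ e y l (yes e<k) = κ λ j k≤j → l j (ℕ.≤-trans e<k k≤j)
    case-≤ e y l (no  e≮k) = *-≉0 x y
      (trans (sym (leading-⊛ {P} {Q} h l)) (b (d ℕ.+ e) (ℕ.+-monoʳ-≤ d (ℕ.≮⇒≥ e≮k))))

  NonZero⇒≉[] : ∀ {P} → NonZeroP K P → ¬ (P ≋ [])
  NonZero⇒≉[] (n , x) e = x (at e n)

  nonzero-degree : ∀ {P} → ¬ (P ≋ []) → ¬ ¬ ∃ (Degree P)
  nonzero-degree {P} P≉0 h = zero-or-degree P λ where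
    (inj₁ P≋[]) → P≉0 P≋[]
    (inj₂ deg)  → h deg

  ⊛-cancel-≋[] : ∀ {P Q} → ¬ (P ≋ []) → P ⊛ Q ≋ [] → ¬ ¬ (Q ≋ [])
  ⊛-cancel-≋[] {P} {Q} P≉0 e h = nonzero-degree P≉0 λ (d , deg) →
    degreeBelow-cofactor {P} {Q} {d} {0} deg (λ j _ → at e j) λ below → h (mk≋ λ j → below j z≤n)

  ⊛-cancel : ∀ {P} Q R → ¬ (P ≋ []) → P ⊛ Q ≋ P ⊛ R → ¬ ¬ (Q ≋ R)
  ⊛-cancel {P} Q R P≉0 e h = ⊛-cancel-≋[] {P} {Q ⊕ ⊖ R} P≉0
    (begin
      P ⊛ (Q ⊕ ⊖ R)        ≈⟨ P.distribˡ P Q (⊖ R) ⟩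
      P ⊛ Q ⊕ P ⊛ ⊖ R      ≈⟨ P.+-congʳ {P ⊛ ⊖ R} e ⟩
      P ⊛ R ⊕ P ⊛ ⊖ R      ≈⟨ P.distribˡ P R (⊖ R) ⟨
      P ⊛ (R ⊕ ⊖ R)        ≈⟨ P.*-congˡ {P} (⊖-inverseʳ R) ⟩
      P ⊛ []               ≈⟨ ⊛-zeroʳ P ⟩
      []                   ∎)
    λ e′ → h (PR.x∙y⁻¹≈ε⇒x≈y Q R e′)
    where
    open ≋-Reasoning
    import Algebra.Properties.Ring P.ring as PR

  -- Once the tail of the list is divided, `x ∷ r` has degree at most d, and one more multiple of D
  -- removes its coefficient at d. T is the polynomial part of P / D at infinity.
  divide-∞ : ∀ P {D d} → Degree D d → ∃ λ T → ∃ λ r → P ≋ T ⊛ D ⊕ r × DegreeBelow r d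
  divide-∞ []      {D} deg = [] , [] , P.refl , λ _ _ → refl
  divide-∞ (x ∷ P) {D} {d} deg@(D≉0 , below) with divide-∞ P deg
  ... | T , r , e , r-below = t ∷ T , (x ∷ r) ⊕ (- t) ⊙ D , eq , small
    where
    t = (x ∷ r) [ d ] * D [ d ] ⁻¹
    eq : (x ∷ P) ≋ (t ∷ T) ⊛ D ⊕ ((x ∷ r) ⊕ (- t) ⊙ D)
    eq = P.sym (begin
      (t ⊙ D ⊕ (0# ∷ T ⊛ D)) ⊕ ((x ∷ r) ⊕ (- t) ⊙ D)
        ≈⟨ PS.solve 4 (λ a b c d → (a ⟨+⟩ b) ⟨+⟩ (c ⟨+⟩ d) ⟨=⟩ (a ⟨+⟩ d) ⟨+⟩ (b ⟨+⟩ c)) P.refl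
             (t ⊙ D) (0# ∷ T ⊛ D) (x ∷ r) ((- t) ⊙ D) ⟩
      (t ⊙ D ⊕ (- t) ⊙ D) ⊕ ((0# + x) ∷ (T ⊛ D ⊕ r))
        ≈⟨ P.+-cong (P.trans (P.sym (⊙-distribʳ t (- t) D)) (0⊙ D (-‿inverseʳ t))) (∷-cong (+-identityˡ x) (P.sym e)) ⟩
      x ∷ P ∎)
      where open ≋-Reasoning
    top : DegreeBelow (x ∷ r) (suc d)
    top (suc j) (s≤s le) = r-below j le
    small : DegreeBelow ((x ∷ r) ⊕ (- t) ⊙ D) d
    small j d≤j with ℕ.m≤n⇒m<n∨m≡n d≤j
    ... | inj₁ d<j = degreeBelow-⊕ {x ∷ r} {(- t) ⊙ D} top (degreeBelow-⊙ {D} (- t) below) j d<j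
    ... | inj₂ ≡.refl = begin
      ((x ∷ r) ⊕ (- t) ⊙ D) [ d ]                   ≈⟨ coeff-⊕ (x ∷ r) ((- t) ⊙ D) d ⟩
      y + ((- t) ⊙ D) [ d ]                         ≈⟨ +-congˡ (coeff-⊙ (- t) D d) ⟩
      y + (- t) * D [ d ]                           ≈⟨ +-congˡ (-‿distribˡ-* t (D [ d ])) ⟨
      y - y * D [ d ] ⁻¹ * D [ d ]                  ≈⟨ +-congˡ (-‿cong (trans (*-assoc _ _ _) (trans (*-congˡ (trans (*-comm _ _) (inverse _ D≉0))) (*-identityʳ y)))) ⟩
      y - y                                         ≈⟨ -‿inverseʳ y ⟩
      0#                                            ∎
      where
      y = (x ∷ r) [ d ]
      open ≈-Reasoning

  -- Division by ascending powers: T lists the first m coefficients of the power series P / D, which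
  -- exists because D(0) ≠ 0.
  divide-0 : ∀ m P {D} → D [ 0 ] ≉ 0# → ∃ λ T → ∃ λ r → P ≋ T ⊛ D ⊕ shift m r
  divide-0 zero    P {D} D≉0 = [] , P , P.refl
  divide-0 (suc m) P {D} D≉0 = t ∷ T , r , division
    where
    tail : Poly K → Poly K
    tail []      = []
    tail (_ ∷ P) = P
    coeff-tail : ∀ P j → tail P [ j ] ≈ P [ suc j ]
    coeff-tail []      j = refl
    coeff-tail (_ ∷ P) j = refl
    t = P [ 0 ] * D [ 0 ] ⁻¹
    rec = divide-0 m (tail (P ⊕ (- t) ⊙ D)) {D} D≉0
    T = proj₁ rec
    r = proj₁ (proj₂ rec)
    peel : ∀ j → P [ j ] ≈ (t ⊙ D ⊕ (0# ∷ tail (P ⊕ (- t) ⊙ D))) [ j ]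
    peel zero    = sym (trans (coeff-⊕ (t ⊙ D) _ 0) (trans (+-identityʳ _) (trans (coeff-⊙ t D 0)
      (trans (*-assoc _ _ _) (trans (*-congˡ (trans (*-comm _ _) (inverse _ D≉0))) (*-identityʳ _))))))
    peel (suc j) = sym (begin
      (t ⊙ D ⊕ (0# ∷ tail (P ⊕ (- t) ⊙ D))) [ suc j ]   ≈⟨ coeff-⊕ (t ⊙ D) _ (suc j) ⟩
      (t ⊙ D) [ suc j ] + tail (P ⊕ (- t) ⊙ D) [ j ]    ≈⟨ +-cong (coeff-⊙ t D (suc j))
          (trans (coeff-tail (P ⊕ (- t) ⊙ D) j) (trans (coeff-⊕ P ((- t) ⊙ D) (suc j)) (+-congˡ (coeff-⊙ (- t) D (suc j))))) ⟩
      t * y + (P [ suc j ] + (- t) * y)                 ≈⟨ solve 4 (λ t n y x → t :* y :+ (x :+ n :* y) := x :+ (t :+ n) :* y) refl t (- t) y _ ⟩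
      P [ suc j ] + (t - t) * y                         ≈⟨ +-congˡ (trans (*-congʳ (-‿inverseʳ t)) (zeroˡ y)) ⟩
      P [ suc j ] + 0#                                  ≈⟨ +-identityʳ _ ⟩
      P [ suc j ]                                       ∎)
      where
      y = D [ suc j ]
      open ≈-Reasoning
    division : P ≋ (t ∷ T) ⊛ D ⊕ shift (suc m) r
    division = begin
      P                                               ≈⟨ mk≋ peel ⟩
      t ⊙ D ⊕ (0# ∷ tail (P ⊕ (- t) ⊙ D))             ≈⟨ P.+-congˡ {t ⊙ D} (∷-cong (sym (+-identityʳ 0#)) (proj₂ (proj₂ rec))) ⟩
      t ⊙ D ⊕ ((0# ∷ T ⊛ D) ⊕ (0# ∷ shift m r))       ≈⟨ P.+-assoc (t ⊙ D) (0# ∷ T ⊛ D) (0# ∷ shift m r) ⟨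
      (t ∷ T) ⊛ D ⊕ shift (suc m) r                   ∎
      where open ≋-Reasoning

  order-at-0 : ∀ P → ¬ (P ≋ []) → ¬ ¬ (∃ λ m → ∃ λ v → P ≋ shift m v × v [ 0 ] ≉ 0#)
  order-at-0 []      P≉0 _ = P≉0 P.refl
  order-at-0 (a ∷ P) P≉0 h = ¬¬-excluded-middle λ where
    (no  a≉0) → h (0 , a ∷ P , P.refl , a≉0)
    (yes a≈0) → order-at-0 P (λ P≋[] → P≉0 (∷≋[] a≈0 P≋[])) λ (m , v , e , v≉0) →
      h (suc m , v , ∷-cong a≈0 e , v≉0)

  -- P is invertible as a power series, so a factor x^k of the product belongs to R. This is the
  -- counterpart at 0 of `degreeBelow-cofactor`.
  low-coefficients-vanish : ∀ k {P} R S → P [ 0 ] ≉ 0# → P ⊛ R ≋ shift k S → ∀ j → j ℕ.< k → R [ j ] ≈ 0#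
  low-coefficients-vanish k       []      S P≉0 e j       _ = refl
  low-coefficients-vanish (suc k) {P} (r ∷ R) S P≉0 e j lt = go j lt
    where
    e′ : r ⊙ P ⊕ (0# ∷ P ⊛ R) ≋ shift (suc k) S
    e′ = P.trans (P.sym (⊛-∷ P r R)) e
    r≈0 : r ≈ 0#
    r≈0 = x*y≈0⇒y≈0 P≉0 (trans (*-comm _ r) (trans (sym (coeff-⊙ r P 0))
      (trans (sym (+-identityʳ _)) (trans (sym (coeff-⊕ (r ⊙ P) (0# ∷ P ⊛ R) 0)) (at e′ 0)))))
    rest : P ⊛ R ≋ shift k S
    rest = tail-≋ {0#} {0#} (P.trans (P.sym (P.+-congʳ {0# ∷ P ⊛ R} (0⊙ P r≈0))) e′)
    go : ∀ j → j ℕ.< suc k → (r ∷ R) [ j ] ≈ 0#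
    go zero    _         = r≈0
    go (suc j) (s≤s j<k) = low-coefficients-vanish k {P} R S P≉0 rest j j<k

  shift-+ : ∀ j k P → shift j (shift k P) ≡ shift (j ℕ.+ k) P
  shift-+ zero    k P = ≡.refl
  shift-+ (suc j) k P = ≡.cong (0# ∷_) (shift-+ j k P)

  σ-shift : ∀ m P → σ (shift m P) ≋ shift (m ℕ.* p) (σ P)
  σ-shift zero    P = P.refl
  σ-shift (suc m) P = ∷-cong refl (P.trans (shift-cong q (σ-shift m P)) (P.reflexive (shift-+ q (m ℕ.* p) (σ P))))

  -- The coefficient of x⁻ⁱ in x⁻ⁿ P (0 when i > n).
  backward : Poly K → ℕ → ℕ → Carrier
  backward P n       zero    = P [ n ]
  backward P zero    (suc i) = 0#
  backward P (suc n) (suc i) = backward P n i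

  backward-∷ : ∀ P n i → backward (0# ∷ P) (suc n) i ≈ backward P n i
  backward-∷ P n       zero    = refl
  backward-∷ P zero    (suc zero)    = refl
  backward-∷ P zero    (suc (suc i)) = refl
  backward-∷ P (suc n) (suc i) = backward-∷ P n i

  backward-shift : ∀ k P n i → backward (shift k P) (k ℕ.+ n) i ≈ backward P n i
  backward-shift zero    P n i = refl
  backward-shift (suc k) P n i = trans (backward-∷ (shift k P) (k ℕ.+ n) i) (backward-shift k P n i)

  backward-relation : ∀ A B C κ n → (∀ j → j ℕ.≤ n → A [ j ] + B [ j ] ≈ κ * C [ j ]) →
                      ∀ i → backward A n i + backward B n i ≈ κ * backward C n i
  backward-relation A B C κ n       h zero    = h n ℕ.≤-refl
  backward-relation A B C κ zero    h (suc i) = trans (+-identityʳ 0#) (sym (zeroʳ κ))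
  backward-relation A B C κ (suc n) h (suc i) =
    backward-relation A B C κ n (λ j j≤n → h j (ℕ.m≤n⇒m≤1+n j≤n)) i

  backward-+ : ∀ P k n i → backward P (k ℕ.+ n) (k ℕ.+ i) ≡ backward P n i
  backward-+ P zero    n i = ≡.refl
  backward-+ P (suc k) n i = backward-+ P k n i

  backward-beyond : ∀ P n i → n ℕ.< i → backward P n i ≈ 0#
  backward-beyond P zero    (suc i) _        = refl
  backward-beyond P (suc n) (suc i) (s≤s lt) = backward-beyond P n i lt

  -- The offset m * p arises because σ sends x^(-m) P to x^(-mp) σ(P).
  backward-σ-multiple : ∀ P m j → backward (σ P) (m ℕ.* p) (j ℕ.* p) ≈ backward P m j
  backward-σ-multiple P m       zero    = coeff-σ-multiple P m
  backward-σ-multiple P zero    (suc j) = refl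
  backward-σ-multiple P (suc m) (suc j) =
    trans (reflexive (backward-+ (σ P) p (m ℕ.* p) (j ℕ.* p))) (backward-σ-multiple P m j)

  backward-≤ : ∀ P n i k → n ≡ i ℕ.+ k → backward P n i ≡ P [ k ]
  backward-≤ P n zero    k ≡.refl = ≡.refl
  backward-≤ P _ (suc i) k ≡.refl = backward-≤ P (i ℕ.+ k) i k ≡.refl

  backward-σ-other : ∀ P m i → ¬ (p ∣ i) → backward (σ P) (m ℕ.* p) i ≈ 0#
  backward-σ-other P m i p∤i with i ℕ.≤? m ℕ.* p
  ... | no  i≰ = backward-beyond (σ P) (m ℕ.* p) i (ℕ.≰⇒> i≰)
  ... | yes i≤ with ℕ.m≤n⇒∃[o]m+o≡n i≤
  ...   | k , e = trans (reflexive (backward-≤ (σ P) (m ℕ.* p) i k (≡.sym e)))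
          (coeff-σ-other P k λ p∣k → p∤i (∣m+n∣m⇒∣n (≡.subst (p ∣_) (≡.trans (≡.sym e) (ℕ.+-comm i k)) (divides m ≡.refl)) p∣k))

-- The coefficient recursion and the expansions of g at infinity and at 0

module Expansions {c ℓ : Level} (K : ACField c ℓ) (q : ℕ) (1≤q : 1 ℕ.≤ q) where
  open ACField K
  open Polynomials K
  open Field K
  open LocalFactors K
  open Spread K q
  open Degrees K q
  open import Algebra.Properties.Ring ring

  1<p : 1 ℕ.< p
  1<p = s≤s 1≤q

  i<pⁱ : ∀ i → i ℕ.< p ℕ.^ i
  i<pⁱ zero    = s≤s z≤n
  i<pⁱ (suc i) = ℕ.≤-<-trans (i<pⁱ i) (ℕ.^-monoʳ-< p 1<p (ℕ.n<1+n i))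

  -- ψ i plays the role of φ (i / p).
  module Functional
    {κ : Carrier} (κ≉0 : κ ≉ 0#) {coef φ ψ : ℕ → Carrier}
    (relation : ∀ i → 0 ℕ.< i → coef i + φ i ≈ κ * ψ i)
    (ψ-multiple : ∀ j → ψ (j ℕ.* p) ≈ φ j)
    (ψ-other : ∀ i → ¬ (p ∣ i) → ψ i ≈ 0#)
    (no-disp : ∀ j d → 0 ℕ.< j → 0 ℕ.< d → coef j ≉ 0# → coef (j ℕ.* p ℕ.^ d) ≉ 0# → ⊥)
    where

    φ≈0 : ∀ {i} → 0 ℕ.< i → coef i ≈ 0# → ψ i ≈ 0# → φ i ≈ 0#
    φ≈0 {i} 0<i coef≈0 ψ≈0 = begin
      φ i            ≈⟨ +-identityˡ _ ⟨
      0# + φ i       ≈⟨ +-congʳ coef≈0 ⟨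
      coef i + φ i   ≈⟨ relation i 0<i ⟩
      κ * ψ i        ≈⟨ *-congˡ ψ≈0 ⟩
      κ * 0#         ≈⟨ zeroʳ κ ⟩
      0#             ∎
      where open ≈-Reasoning

    coef≈0 : ∀ {i} → 0 ℕ.< i → φ i ≈ 0# → ψ i ≈ 0# → coef i ≈ 0#
    coef≈0 {i} 0<i φ≈0 ψ≈0 = begin
      coef i         ≈⟨ +-identityʳ _ ⟨
      coef i + 0#    ≈⟨ +-congˡ φ≈0 ⟨
      coef i + φ i   ≈⟨ relation i 0<i ⟩
      κ * ψ i        ≈⟨ *-congˡ ψ≈0 ⟩
      κ * 0#         ≈⟨ zeroʳ κ ⟩
      0#             ∎
      where open ≈-Reasoning

    ψ≈0 : ∀ {i} → 0 ℕ.< i → coef i ≈ 0# → φ i ≈ 0# → ψ i ≈ 0#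
    ψ≈0 {i} 0<i coef≈0 φ≈0 = x*y≈0⇒y≈0 κ≉0 (trans (sym (relation i 0<i))
      (trans (+-cong coef≈0 φ≈0) (+-identityʳ 0#)))

    0<factor : ∀ k {m} → 0 ℕ.< k ℕ.* m → 0 ℕ.< k
    0<factor (suc k) _ = s≤s z≤n

    p^suc : ∀ k t → k ℕ.* p ℕ.* p ℕ.^ t ≡ k ℕ.* p ℕ.^ suc t
    p^suc k t = ℕ.*-assoc k p (p ℕ.^ t)

    -- The equation j p^(t+1) = i ties every j to the fixed i, so `no-disp` leaves no room for a
    -- nonzero `coef j` and the recursion pushes a nonzero φ from j to j / p. Strong induction on j
    -- ends this.
    descend : ∀ {i} → coef i ≉ 0# → ∀ j t → 0 ℕ.< j → φ j ≉ 0# → j ℕ.* p ℕ.^ suc t ≡ i → ⊥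
    descend {i} coef≉0 = <-rec _ λ j rec t 0<j φj≉0 eq →
      no-disp j (suc t) 0<j (s≤s z≤n)
        (λ coefj≈0 → φj≉0 (φ≈0 0<j coefj≈0 (ψ-vanishes j rec t 0<j φj≉0 eq coefj≈0)))
        (λ z → coef≉0 (≡.subst (λ k → coef k ≈ 0#) eq z))
      where
      ψ-vanishes : ∀ j → (∀ {k} → k ℕ.< j → ∀ t → 0 ℕ.< k → φ k ≉ 0# → k ℕ.* p ℕ.^ suc t ≡ i → ⊥) →
                   ∀ t → 0 ℕ.< j → φ j ≉ 0# → j ℕ.* p ℕ.^ suc t ≡ i → coef j ≈ 0# → ψ j ≈ 0#
      ψ-vanishes j rec t 0<j φj≉0 eq coefj≈0 with p ∣? j
      ... | no p∤j = ψ-other j p∤j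
      ... | yes (divides k ≡.refl) = ⊥-elim (rec (ℕ.m<m*n k p {{ℕ.>-nonZero 0<k}} 1<p) (suc t) 0<k
              (λ φk≈0 → φj≉0 (φ≈0 0<j coefj≈0 (trans (ψ-multiple k) φk≈0)))
              (≡.trans (≡.sym (p^suc k (suc t))) eq))
        where
        0<k = 0<factor k 0<j

    -- Each step trades φ at i p^(t+1) for φ at i p^t by way of ψ. That the coefficient there
    -- vanishes is known from `no-disp` only under a double negation, which the conclusion inherits.
    ascend : ∀ {i} → 0 ℕ.< i → coef i ≉ 0# → ∀ t → φ (i ℕ.* p ℕ.^ t) ≈ 0# → ¬ ¬ (φ i ≈ 0#)
    ascend {i} 0<i coef≉0 zero    e h = h (≡.subst (λ k → φ k ≈ 0#) (ℕ.*-identityʳ i) e)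
    ascend {i} 0<i coef≉0 (suc t) e h = no-disp i (suc t) 0<i (s≤s z≤n) coef≉0 λ coef≈0 →
      ascend 0<i coef≉0 t (trans (sym (ψ-multiple (i ℕ.* p ℕ.^ t)))
        (≡.subst (λ k → ψ k ≈ 0#) (swap i (p ℕ.^ t) p)
          (ψ≈0 (ℕ.*-mono-< {0} {i} {0} 0<i (ℕ.m^n>0 p (suc t))) coef≈0 e))) h
      where
      swap : ∀ i x p → i ℕ.* (p ℕ.* x) ≡ i ℕ.* x ℕ.* p
      swap = ℕ.solve-∀

    dispersed : ∀ N → (∀ i → N ℕ.≤ i → φ i ≈ 0#) → ∀ i → 0 ℕ.< i → coef i ≉ 0# → ⊥
    dispersed N φ-finite i 0<i coef≉0 =
      -- Since N < p^N, the starting index i p^N lies beyond the support of φ.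
      ascend 0<i coef≉0 N (φ-finite _ (ℕ.≤-trans (ℕ.<⇒≤ (i<pⁱ N)) (ℕ.m≤n*m (p ℕ.^ N) i {{ℕ.>-nonZero 0<i}})))
        λ φi≈0 → coef≉0 (coef≈0 0<i φi≈0 (ψi≈0 φi≈0))
      where
      ψi≈0 : φ i ≈ 0# → ψ i ≈ 0#
      ψi≈0 φi≈0 with p ∣? i
      ... | no p∤i = ψ-other i p∤i
      ... | yes (divides k e) = ⊥-elim (descend coef≉0 k 0 0<k
              (λ φk≈0 → coef≉0 (coef≈0 0<i φi≈0
                (≡.subst (λ j → ψ j ≈ 0#) (≡.sym e) (trans (ψ-multiple k) φk≈0))))
              (≡.trans (≡.cong (k ℕ.*_) (ℕ.*-identityʳ p)) (≡.sym e)))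
        where
        0<k = 0<factor k (≡.subst (0 ℕ.<_) e 0<i)

  module Decomposition (fn fd gn gd : Poly K) {κ : Carrier} (κ≉0 : κ ≉ 0#)
    (summable : (fn ⊛ (σ gd ⊛ gd)) ≋ ((κ ⊙ (σ gn ⊛ gd)) ⊕ ⊖ (gn ⊛ σ gd)) ⊛ fd)
    (fd≉0 : ¬ (fd ≋ []))
    (n : ℕ) (A a b : Poly K)
    (decomposition : (fn ⊛ (xpow K n ⊛ b)) ≋ (A ⊛ b ⊕ a ⊛ xpow K n) ⊛ fd)
    where

    N : Poly K
    N = xpow K n

    -- Putting A / N + a / b for f into `summable` leaves `fd` as a common factor; cancelling it
    -- costs the double negation.
    cleared : ¬ ¬ ((A ⊛ b ⊕ a ⊛ N) ⊛ (σ gd ⊛ gd) ≋ ((κ ⊙ (σ gn ⊛ gd)) ⊕ ⊖ (gn ⊛ σ gd)) ⊛ (N ⊛ b))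
    cleared = ⊛-cancel {fd} _ _ fd≉0 (begin
      fd ⊛ ((A ⊛ b ⊕ a ⊛ N) ⊛ (σ gd ⊛ gd))      ≈⟨ P.*-assoc fd _ (σ gd ⊛ gd) ⟨
      fd ⊛ (A ⊛ b ⊕ a ⊛ N) ⊛ (σ gd ⊛ gd)        ≈⟨ P.*-congʳ {σ gd ⊛ gd} (P.*-comm fd _) ⟩
      (A ⊛ b ⊕ a ⊛ N) ⊛ fd ⊛ (σ gd ⊛ gd)        ≈⟨ P.*-congʳ {σ gd ⊛ gd} decomposition ⟨
      fn ⊛ (N ⊛ b) ⊛ (σ gd ⊛ gd)                ≈⟨ PS.solve 3 (λ x y z → x ⟨*⟩ y ⟨*⟩ z ⟨=⟩ x ⟨*⟩ z ⟨*⟩ y) P.refl fn (N ⊛ b) (σ gd ⊛ gd) ⟩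
      fn ⊛ (σ gd ⊛ gd) ⊛ (N ⊛ b)                ≈⟨ P.*-congʳ {N ⊛ b} summable ⟩
      Δ ⊛ fd ⊛ (N ⊛ b)                          ≈⟨ PS.solve 3 (λ x y z → x ⟨*⟩ y ⟨*⟩ z ⟨=⟩ y ⟨*⟩ (x ⟨*⟩ z)) P.refl Δ fd (N ⊛ b) ⟩
      fd ⊛ (Δ ⊛ (N ⊛ b))                        ∎)
      where
      open ≋-Reasoning
      Δ = (κ ⊙ (σ gn ⊛ gd)) ⊕ ⊖ (gn ⊛ σ gd)

    -- Both expansions of g are of the shape x⁻ᵐ T + r / v; the one at infinity has m = 0.
    module Expansion (m : ℕ) (v T r : Poly K) (gd≋ : gd ≋ xpow K m ⊛ v) (gn≋ : gn ≋ T ⊛ v ⊕ xpow K m ⊛ r)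
                     (identity : (A ⊛ b ⊕ a ⊛ N) ⊛ (σ gd ⊛ gd) ≋ ((κ ⊙ (σ gn ⊛ gd)) ⊕ ⊖ (gn ⊛ σ gd)) ⊛ (N ⊛ b))
                     where
      -- Write f = A/N + a/b and g = T/X + r/v, so that σ(g) = σT/Y + σr/σv. In f + g - κσ(g) the
      -- Laurent polynomials add up to R/(NXY) and the remaining fractions to -S/W.
      X Y W R S : Poly K
      X = xpow K m
      Y = xpow K (m ℕ.* p)
      W = b ⊛ σ v ⊛ v
      R = (Y ⊛ X ⊛ A ⊕ Y ⊛ N ⊛ T) ⊕ ⊖ (‹ κ › ⊛ (X ⊛ N ⊛ σ T))
      S = ‹ κ › ⊛ σ r ⊛ v ⊛ b ⊕ ⊖ (a ⊛ v ⊛ σ v ⊕ r ⊛ σ v ⊛ b)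

      σ-X⊛ : ∀ P → σ (X ⊛ P) ≋ Y ⊛ σ P
      σ-X⊛ P = P.trans (σ-cong (xpow-⊛ m P)) (P.trans (σ-shift m P) (P.sym (xpow-⊛ (m ℕ.* p) (σ P))))

      σgd≋ : σ gd ≋ Y ⊛ σ v
      σgd≋ = P.trans (σ-cong gd≋) (σ-X⊛ v)

      σgn≋ : σ gn ≋ σ T ⊛ σ v ⊕ Y ⊛ σ r
      σgn≋ = P.trans (σ-cong gn≋) (P.trans (σ-⊕ (T ⊛ v) (X ⊛ r)) (P.+-cong (σ-⊛ T v) (σ-X⊛ r)))

      private
        move : ∀ P Q C → P ≋ (Q ⊕ ⊖ C) → P ⊕ C ≋ Q
        move P Q C e = begin
          P ⊕ C             ≈⟨ P.+-congʳ {C} e ⟩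
          (Q ⊕ ⊖ C) ⊕ C     ≈⟨ P.+-assoc Q (⊖ C) C ⟩
          Q ⊕ (⊖ C ⊕ C)     ≈⟨ P.+-congˡ {Q} (P.trans (P.+-comm (⊖ C) C) (⊖-inverseʳ C)) ⟩
          Q ⊕ []            ≈⟨ ⊕-identityʳ Q ⟩
          Q                 ∎
          where open ≋-Reasoning

        -- The semiring solver wants identities without signs, so `expanded` is proved with each
        -- term on its positive side and then regrouped.
        exchange : ∀ w y P Q C D → w ⊛ P ⊕ y ⊛ Q ≋ w ⊛ C ⊕ y ⊛ D → w ⊛ (P ⊕ ⊖ C) ≋ y ⊛ (D ⊕ ⊖ Q)
        exchange w y P Q C D e = PR.+-cancelʳ (w ⊛ C ⊕ y ⊛ Q) _ _ (begin
          w ⊛ (P ⊕ ⊖ C) ⊕ (w ⊛ C ⊕ y ⊛ Q)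
            ≈⟨ PS.solve 6 (λ w y p c c′ q → w ⟨*⟩ (p ⟨+⟩ c′) ⟨+⟩ (w ⟨*⟩ c ⟨+⟩ y ⟨*⟩ q) ⟨=⟩ w ⟨*⟩ p ⟨+⟩ y ⟨*⟩ q ⟨+⟩ w ⟨*⟩ (c ⟨+⟩ c′)) P.refl w y P C (⊖ C) Q ⟩
          w ⊛ P ⊕ y ⊛ Q ⊕ w ⊛ (C ⊕ ⊖ C)
            ≈⟨ P.+-cong e (zero⊛ w C) ⟩
          w ⊛ C ⊕ y ⊛ D ⊕ []
            ≈⟨ P.+-congˡ {w ⊛ C ⊕ y ⊛ D} (zero⊛ y Q) ⟨
          w ⊛ C ⊕ y ⊛ D ⊕ y ⊛ (Q ⊕ ⊖ Q)
            ≈⟨ PS.solve 6 (λ w y d c q q′ → w ⟨*⟩ c ⟨+⟩ y ⟨*⟩ d ⟨+⟩ y ⟨*⟩ (q ⟨+⟩ q′) ⟨=⟩ y ⟨*⟩ (d ⟨+⟩ q′) ⟨+⟩ (w ⟨*⟩ c ⟨+⟩ y ⟨*⟩ q)) P.refl w y D C Q (⊖ Q) ⟩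
          y ⊛ (D ⊕ ⊖ Q) ⊕ (w ⊛ C ⊕ y ⊛ Q) ∎)
          where
          open ≋-Reasoning
          import Algebra.Properties.Ring P.ring as PR
          zero⊛ : ∀ w C → w ⊛ (C ⊕ ⊖ C) ≋ []
          zero⊛ w C = P.trans (P.*-congˡ {w} (⊖-inverseʳ C)) (⊛-zeroʳ w)

      expanded : W ⊛ R ≋ (N ⊛ X ⊛ Y) ⊛ S
      expanded = exchange W (N ⊛ X ⊛ Y) (Y ⊛ X ⊛ A ⊕ Y ⊛ N ⊛ T) (a ⊛ v ⊛ σ v ⊕ r ⊛ σ v ⊛ b)
                          (‹ κ › ⊛ (X ⊛ N ⊛ σ T)) (‹ κ › ⊛ σ r ⊛ v ⊛ b) (begin
        W ⊛ (Y ⊛ X ⊛ A ⊕ Y ⊛ N ⊛ T) ⊕ (N ⊛ X ⊛ Y) ⊛ (a ⊛ v ⊛ σ v ⊕ r ⊛ σ v ⊛ b)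
          ≈⟨ PS.solve 10 (λ b v v′ X Y N A a T r →
               b ⟨*⟩ v′ ⟨*⟩ v ⟨*⟩ (Y ⟨*⟩ X ⟨*⟩ A ⟨+⟩ Y ⟨*⟩ N ⟨*⟩ T) ⟨+⟩ (N ⟨*⟩ X ⟨*⟩ Y) ⟨*⟩ (a ⟨*⟩ v ⟨*⟩ v′ ⟨+⟩ r ⟨*⟩ v′ ⟨*⟩ b)
               ⟨=⟩ (A ⟨*⟩ b ⟨+⟩ a ⟨*⟩ N) ⟨*⟩ (Y ⟨*⟩ v′ ⟨*⟩ (X ⟨*⟩ v)) ⟨+⟩ (T ⟨*⟩ v ⟨+⟩ X ⟨*⟩ r) ⟨*⟩ (Y ⟨*⟩ v′) ⟨*⟩ (N ⟨*⟩ b))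
               P.refl b v (σ v) X Y N A a T r ⟩
        (A ⊛ b ⊕ a ⊛ N) ⊛ (Y ⊛ σ v ⊛ (X ⊛ v)) ⊕ (T ⊛ v ⊕ X ⊛ r) ⊛ (Y ⊛ σ v) ⊛ (N ⊛ b)
          ≈⟨ P.+-cong (P.*-congˡ {A ⊛ b ⊕ a ⊛ N} (P.*-cong σgd≋ gd≋))
               (P.*-congʳ {N ⊛ b} (P.*-cong gn≋ σgd≋)) ⟨
        (A ⊛ b ⊕ a ⊛ N) ⊛ (σ gd ⊛ gd) ⊕ gn ⊛ σ gd ⊛ (N ⊛ b)
          ≈⟨ P.+-congʳ {gn ⊛ σ gd ⊛ (N ⊛ b)} identity ⟩
        ((κ ⊙ (σ gn ⊛ gd)) ⊕ ⊖ (gn ⊛ σ gd)) ⊛ (N ⊛ b) ⊕ gn ⊛ σ gd ⊛ (N ⊛ b)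
          ≈⟨ P.distribʳ (N ⊛ b) ((κ ⊙ (σ gn ⊛ gd)) ⊕ ⊖ (gn ⊛ σ gd)) (gn ⊛ σ gd) ⟨
        ((κ ⊙ (σ gn ⊛ gd)) ⊕ ⊖ (gn ⊛ σ gd) ⊕ gn ⊛ σ gd) ⊛ (N ⊛ b)
          ≈⟨ P.*-congʳ {N ⊛ b} (move _ (κ ⊙ (σ gn ⊛ gd)) (gn ⊛ σ gd) P.refl) ⟩
        (κ ⊙ (σ gn ⊛ gd)) ⊛ (N ⊛ b)
          ≈⟨ P.*-congʳ {N ⊛ b} (P.trans (P.sym (const-⊛ κ (σ gn ⊛ gd))) (P.*-congˡ {‹ κ ›} (P.*-cong σgn≋ gd≋))) ⟩
        ‹ κ › ⊛ ((σ T ⊛ σ v ⊕ Y ⊛ σ r) ⊛ (X ⊛ v)) ⊛ (N ⊛ b)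
          ≈⟨ PS.solve 9 (λ k b v v′ X Y N T′ r′ →
               k ⟨*⟩ ((T′ ⟨*⟩ v′ ⟨+⟩ Y ⟨*⟩ r′) ⟨*⟩ (X ⟨*⟩ v)) ⟨*⟩ (N ⟨*⟩ b)
               ⟨=⟩ b ⟨*⟩ v′ ⟨*⟩ v ⟨*⟩ (k ⟨*⟩ (X ⟨*⟩ N ⟨*⟩ T′)) ⟨+⟩ N ⟨*⟩ X ⟨*⟩ Y ⟨*⟩ (k ⟨*⟩ r′ ⟨*⟩ v ⟨*⟩ b))
               P.refl ‹ κ › b v (σ v) X Y N (σ T) (σ r) ⟩
        W ⊛ (‹ κ › ⊛ (X ⊛ N ⊛ σ T)) ⊕ (N ⊛ X ⊛ Y) ⊛ (‹ κ › ⊛ σ r ⊛ v ⊛ b) ∎)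
        where open ≋-Reasoning

      xpow²-⊛ : ∀ j k P → xpow K j ⊛ xpow K k ⊛ P ≋ shift (j ℕ.+ k) P
      xpow²-⊛ j k P = begin
        xpow K j ⊛ xpow K k ⊛ P       ≈⟨ P.*-assoc (xpow K j) (xpow K k) P ⟩
        xpow K j ⊛ (xpow K k ⊛ P)     ≈⟨ xpow-⊛ j (xpow K k ⊛ P) ⟩
        shift j (xpow K k ⊛ P)        ≈⟨ shift-cong j (xpow-⊛ k P) ⟩
        shift j (shift k P)           ≡⟨ shift-+ j k P ⟩
        shift (j ℕ.+ k) P             ∎
        where open ≋-Reasoning

      relation : ∀ j → R [ j ] ≈ 0# →
        shift (m ℕ.* p ℕ.+ m) A [ j ] + shift (m ℕ.* p ℕ.+ n) T [ j ] ≈ κ * shift (m ℕ.+ n) (σ T) [ j ]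
      relation j R≈0 = begin
        shift (m ℕ.* p ℕ.+ m) A [ j ] + shift (m ℕ.* p ℕ.+ n) T [ j ]
          ≈⟨ +-cong (at (xpow²-⊛ (m ℕ.* p) m A) j) (at (xpow²-⊛ (m ℕ.* p) n T) j) ⟨
        (Y ⊛ X ⊛ A) [ j ] + (Y ⊛ N ⊛ T) [ j ]
          ≈⟨ coeff-⊕ (Y ⊛ X ⊛ A) (Y ⊛ N ⊛ T) j ⟨
        (Y ⊛ X ⊛ A ⊕ Y ⊛ N ⊛ T) [ j ]
          ≈⟨ x∙y⁻¹≈ε⇒x≈y _ _ (trans (trans (+-congˡ (sym (coeff-⊖ C j))) (sym (coeff-⊕ (Y ⊛ X ⊛ A ⊕ Y ⊛ N ⊛ T) (⊖ C) j))) R≈0) ⟩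
        C [ j ]
          ≈⟨ at (const-⊛ κ (X ⊛ N ⊛ σ T)) j ⟩
        (κ ⊙ (X ⊛ N ⊛ σ T)) [ j ]
          ≈⟨ coeff-⊙ κ (X ⊛ N ⊛ σ T) j ⟩
        κ * (X ⊛ N ⊛ σ T) [ j ]
          ≈⟨ *-congˡ (at (xpow²-⊛ m n (σ T)) j) ⟩
        κ * shift (m ℕ.+ n) (σ T) [ j ] ∎
        where
        C = ‹ κ › ⊛ (X ⊛ N ⊛ σ T)
        open ≈-Reasoning

    -- Here g = T + r/gd with deg r < deg gd, and each part of S is proper over W, so deg S < deg W.
    -- Then W R = x^n S gives deg R < n, and the coefficients of R from n on belong to the powers
    -- x^i with i ≥ 0.
    at-∞ : ∀ {d} → Degree b d → DegreeBelow a d → ¬ (gd ≋ []) →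
           ¬ ¬ (∃ λ T → ∀ i → A [ n ℕ.+ i ] + T [ i ] ≈ κ * σ T [ i ])
    at-∞ {d} b-degree a-below gd≉0 h = cleared λ identity → nonzero-degree gd≉0 λ (m , gd-degree) →
      let (T , r , gn≋ , r-below) = divide-∞ gn gd-degree
          open Expansion 0 gd T r (P.sym (P.*-identityˡ gd))
                 (P.trans gn≋ (P.+-congˡ {T ⊛ gd} (P.sym (P.*-identityˡ r)))) identity
          w = d ℕ.+ m ℕ.* p ℕ.+ m
          gd-below = proj₂ gd-degree
          σgd-below = proj₂ (degree-σ {gd} gd-degree)
          W-degree : Degree W w
          W-degree = degree-⊛ {b ⊛ σ gd} {gd} (degree-⊛ {b} {σ gd} b-degree (degree-σ {gd} gd-degree)) gd-degree
          κσr-below : DegreeBelow (‹ κ › ⊛ σ r) (m ℕ.* p)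
          κσr-below = degreeBelow-≋ {κ ⊙ σ r} (P.sym (const-⊛ κ (σ r))) (degreeBelow-⊙ {σ r} κ (degreeBelow-σ {r} r-below))
          first : DegreeBelow (‹ κ › ⊛ σ r ⊛ gd ⊛ b) w
          first = ≡.subst (DegreeBelow (‹ κ › ⊛ σ r ⊛ gd ⊛ b)) (eq₁ d (m ℕ.* p) m)
            (degreeBelow-⊛ {‹ κ › ⊛ σ r ⊛ gd} {b} (degreeBelow-⊛ {‹ κ › ⊛ σ r} {gd} κσr-below gd-below) (proj₂ b-degree))
          second : DegreeBelow (a ⊛ gd ⊛ σ gd) w
          second = ≡.subst (DegreeBelow (a ⊛ gd ⊛ σ gd)) (eq₂ d (m ℕ.* p) m)
            (degreeBelow-⊛ {a ⊛ gd} {σ gd} (degreeBelow-⊛ {a} {gd} a-below gd-below) σgd-below)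
          third : DegreeBelow (r ⊛ σ gd ⊛ b) w
          third = ≡.subst (DegreeBelow (r ⊛ σ gd ⊛ b)) (eq₃ d (m ℕ.* p) m)
            (degreeBelow-⊛ {r ⊛ σ gd} {b} (degreeBelow-⊛ {r} {σ gd} r-below σgd-below) (proj₂ b-degree))
          S-below : DegreeBelow S w
          S-below = degreeBelow-⊕ {‹ κ › ⊛ σ r ⊛ gd ⊛ b} {⊖ (a ⊛ gd ⊛ σ gd ⊕ r ⊛ σ gd ⊛ b)} first
            (degreeBelow-⊖ {a ⊛ gd ⊛ σ gd ⊕ r ⊛ σ gd ⊛ b} (degreeBelow-⊕ {a ⊛ gd ⊛ σ gd} {r ⊛ σ gd ⊛ b} second third))
          NXYS≋ : (N ⊛ X ⊛ Y) ⊛ S ≋ shift n S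
          NXYS≋ = P.trans (P.*-congʳ {S} (P.trans (P.*-identityʳ (N ⊛ X)) (P.*-identityʳ N))) (xpow-⊛ n S)
      in degreeBelow-cofactor {W} {R} {w} {n} W-degree
           (degreeBelow-≋ {shift n S} (P.sym (P.trans expanded NXYS≋)) (≡.subst (DegreeBelow (shift n S)) (ℕ.+-comm n w) (degreeBelow-shift n {S} S-below)))
           λ R-below → h (T , λ i → trans (+-congˡ (sym (coeff-shift n T i)))
             (trans (relation (n ℕ.+ i) (R-below (n ℕ.+ i) (ℕ.m≤m+n n i))) (*-congˡ (coeff-shift n (σ T) i))))
      where
      degreeBelow-shift : ∀ k {P d} → DegreeBelow P d → DegreeBelow (shift k P) (k ℕ.+ d)
      degreeBelow-shift zero    below j       le       = below j le
      degreeBelow-shift (suc k) {P} below (suc j) (s≤s le) = degreeBelow-shift k {P} below j le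
      eq₁ : ∀ d x m → x ℕ.+ m ℕ.+ d ≡ d ℕ.+ x ℕ.+ m
      eq₁ = ℕ.solve-∀
      eq₂ : ∀ d x m → d ℕ.+ m ℕ.+ x ≡ d ℕ.+ x ℕ.+ m
      eq₂ = ℕ.solve-∀
      eq₃ : ∀ d x m → m ℕ.+ x ℕ.+ d ≡ d ℕ.+ x ℕ.+ m
      eq₃ = ℕ.solve-∀

    -- Here g = T/x^m + r/v with v(0) ≠ 0. Thus W(0) ≠ 0, and W R = x^M S kills the first M
    -- coefficients of R. After division by x^M these belong to negative exponents, so i starts at
    -- 1.
    at-0 : b [ 0 ] ≉ 0# → ¬ (gd ≋ []) →
           ¬ ¬ (∃ λ T → ∃ λ m → ∀ i → 0 ℕ.< i →
                backward A n i + backward T m i ≈ κ * backward (σ T) (m ℕ.* p) i)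
    at-0 b≉0 gd≉0 h = cleared λ identity → order-at-0 gd gd≉0 λ (m , v , gd≋ , v≉0) →
      let (T , r , gn≋) = divide-0 m gn {v} v≉0
          open Expansion m v T r (P.trans gd≋ (P.sym (xpow-⊛ m v)))
                 (P.trans gn≋ (P.+-congˡ {T ⊛ v} (P.sym (xpow-⊛ m r)))) identity
          M = n ℕ.+ m ℕ.+ m ℕ.* p
          W≉0 : W [ 0 ] ≉ 0#
          W≉0 e = *-≉0 (*-≉0 b≉0 v≉0) v≉0 (trans (sym (trans (coeff-⊛-0 (b ⊛ σ v) v)
            (*-congʳ (trans (coeff-⊛-0 b (σ v)) (*-congˡ (coeff-σ-multiple v 0)))))) e)
          NXYS≋ : (N ⊛ X ⊛ Y) ⊛ S ≋ shift M S
          NXYS≋ = P.trans (P.*-assoc (N ⊛ X) Y S) (P.trans (xpow²-⊛ n m (Y ⊛ S))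
            (P.trans (shift-cong (n ℕ.+ m) (xpow-⊛ (m ℕ.* p) S)) (P.reflexive (shift-+ (n ℕ.+ m) (m ℕ.* p) S))))
          vanish = low-coefficients-vanish M {W} R S W≉0 (P.trans expanded NXYS≋)
      in h (T , m , λ i 0<i → begin
        backward A n i + backward T m i
          ≈⟨ +-cong (backward-shift′ (m ℕ.* p ℕ.+ m) n A (eq₁ n m (m ℕ.* p)) i) (backward-shift′ (m ℕ.* p ℕ.+ n) m T (eq₂ n m (m ℕ.* p)) i) ⟨
        backward (shift (m ℕ.* p ℕ.+ m) A) M i + backward (shift (m ℕ.* p ℕ.+ n) T) M i
          ≈⟨ backward-relation-< _ _ _ κ M (λ j j<M → relation j (vanish j j<M)) i 0<i ⟩
        κ * backward (shift (m ℕ.+ n) (σ T)) M i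
          ≈⟨ *-congˡ (backward-shift′ (m ℕ.+ n) (m ℕ.* p) (σ T) (eq₃ n m (m ℕ.* p)) i) ⟩
        κ * backward (σ T) (m ℕ.* p) i ∎)
      where
      open ≈-Reasoning
      coeff-⊛-0 : ∀ P Q → (P ⊛ Q) [ 0 ] ≈ P [ 0 ] * Q [ 0 ]
      coeff-⊛-0 []      Q = sym (zeroˡ _)
      coeff-⊛-0 (x ∷ P) Q = trans (coeff-⊕ (x ⊙ Q) (0# ∷ P ⊛ Q) 0) (trans (+-identityʳ _) (coeff-⊙ x Q 0))
      backward-shift′ : ∀ k l P {j} → j ≡ k ℕ.+ l → ∀ i → backward (shift k P) j i ≈ backward P l i
      backward-shift′ k l P ≡.refl = backward-shift k P l
      backward-relation-< : ∀ A B C κ n → (∀ j → j ℕ.< n → A [ j ] + B [ j ] ≈ κ * C [ j ]) →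
                            ∀ i → 0 ℕ.< i → backward A n i + backward B n i ≈ κ * backward C n i
      backward-relation-< A B C κ zero    h (suc i) _ = trans (+-identityʳ 0#) (sym (zeroʳ κ))
      backward-relation-< A B C κ (suc n) h (suc i) _ = backward-relation A B C κ n (λ j j≤n → h j (s≤s j≤n)) i
      eq₁ : ∀ n m x → n ℕ.+ m ℕ.+ x ≡ x ℕ.+ m ℕ.+ n
      eq₁ = ℕ.solve-∀
      eq₂ : ∀ n m x → n ℕ.+ m ℕ.+ x ≡ x ℕ.+ n ℕ.+ m
      eq₂ = ℕ.solve-∀
      eq₃ : ∀ n m x → n ℕ.+ m ℕ.+ x ≡ m ℕ.+ n ℕ.+ x
      eq₃ = ℕ.solve-∀

-- Powers of p in the field, and periodic points as roots of unity

module RootsOfUnity {c ℓ : Level} (K : ACField c ℓ) (q : ℕ) (1≤q : 1 ≤ q) where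
  open ACField K
  open Field K
  open Mahler K (suc q)
  open Expansions K q 1≤q using (1<p)

  p : ℕ
  p = suc q

  pK≉0 : pK ≉ 0#
  pK≉0 = char0 q

  pK⁻¹≉0 : pK ⁻¹ ≉ 0#
  pK⁻¹≉0 e = 1≉0 (trans (sym (inverse pK pK≉0)) (trans (*-congˡ e) (zeroʳ pK)))

  pPow≉0 : ∀ l → pPow l ≉ 0#
  pPow≉0 (+ n)    = ^-≉0 n pK≉0
  pPow≉0 -[1+ n ] = ^-≉0 (suc n) pK⁻¹≉0

  p^-injective : ∀ i j → p ℕ.^ i ≡ p ℕ.^ j → i ≡ j
  p^-injective i j e with ℕ.<-cmp i j
  ... | tri< i<j _ _ = ⊥-elim (ℕ.<-irrefl e (ℕ.^-monoʳ-< p 1<p i<j))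
  ... | tri≈ _ i≡j _ = i≡j
  ... | tri> _ _ j<i = ⊥-elim (ℕ.<-irrefl (≡.sym e) (ℕ.^-monoʳ-< p 1<p j<i))

  pK^-injective : ∀ i j → pK ^ i ≈ pK ^ j → i ≡ j
  pK^-injective i j e = p^-injective i j (fromℕ-injective _ _
    (trans (fromℕ-^ p i) (trans e (sym (fromℕ-^ p j)))))

  -- Roots cannot be extracted uniquely in the field, but both sides are powers of the integer p and
  -- their exponents can be compared. A negative λ would make a positive power of p equal to 1.
  exponent-unique : ∀ l n e → (pK ^ n) ^ suc e ≈ pPow l ^ suc e → l ≡ + n
  exponent-unique (+ m) n e eq = ≡.cong +_ (ℕ.*-cancelʳ-≡ m n (suc e)
    (pK^-injective _ _ (trans (sym (^-* pK m (suc e))) (trans (sym eq) (^-* pK n (suc e))))))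
  exponent-unique -[1+ m ] n e eq = ⊥-elim (ℕ.1+n≢0 (ℕ.m+n≡0⇒m≡0 (suc m ℕ.* suc e)
    (pK^-injective (suc m ℕ.* suc e ℕ.+ n ℕ.* suc e) 0 (begin
      pK ^ (suc m ℕ.* suc e ℕ.+ n ℕ.* suc e)                 ≈⟨ ^-+ pK (suc m ℕ.* suc e) (n ℕ.* suc e) ⟩
      pK ^ (suc m ℕ.* suc e) * pK ^ (n ℕ.* suc e)            ≈⟨ *-cong (^-* pK (suc m) (suc e)) (^-* pK n (suc e)) ⟨
      (pK ^ suc m) ^ suc e * (pK ^ n) ^ suc e                ≈⟨ *-congˡ eq ⟩
      (pK ^ suc m) ^ suc e * ((pK ⁻¹) ^ suc m) ^ suc e       ≈⟨ *-^ (pK ^ suc m) ((pK ⁻¹) ^ suc m) (suc e) ⟨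
      (pK ^ suc m * (pK ⁻¹) ^ suc m) ^ suc e                 ≈⟨ ^-cong (suc e) (*-^ pK (pK ⁻¹) (suc m)) ⟨
      ((pK * pK ⁻¹) ^ suc m) ^ suc e                         ≈⟨ ^-cong (suc e) (trans (^-cong (suc m) (inverse pK pK≉0)) (1^ (suc m))) ⟩
      1# ^ suc e                                             ≈⟨ 1^ (suc e) ⟩
      1#                                                     ∎))))
    where open import Relation.Binary.Reasoning.Setoid setoid

  Order : Carrier → ℕ → Set ℓ
  Order ζ n = 0 ℕ.< n × ζ ^ n ≈ 1# × (∀ m → 0 ℕ.< m → m ℕ.< n → ¬ (ζ ^ m ≈ 1#))

  order-exists : ∀ ζ N → 0 ℕ.< N → ζ ^ N ≈ 1# → ¬ ¬ ∃ (Order ζ)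
  order-exists ζ N 0<N e h = none N 0<N e
    where
    none : ∀ n → 0 ℕ.< n → ¬ (ζ ^ n ≈ 1#)
    none = <-rec _ λ n rec 0<n e → h (n , 0<n , e , λ m 0<m m<n → rec m<n 0<m)

  order-∣ : ∀ {ζ n} N → Order ζ n → ζ ^ N ≈ 1# → n ∣ N
  order-∣ {ζ} {n@(suc _)} N (_ , ζⁿ≈1 , least) ζᴺ≈1 with N % n in eq
  ... | zero  = m%n≡0⇒n∣m N n eq
  ... | suc r = ⊥-elim (least (suc r) (s≤s z≤n) (≡.subst (ℕ._< n) eq (m%n<n N n)) (begin
    ζ ^ suc r                              ≈⟨ ^-≡ ζ eq ⟨
    ζ ^ (N % n)                            ≈⟨ *-identityʳ _ ⟨
    ζ ^ (N % n) * 1#                       ≈⟨ *-congˡ (trans (^-cong (N / n) ζⁿ≈1) (1^ (N / n))) ⟨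
    ζ ^ (N % n) * (ζ ^ n) ^ (N / n)        ≈⟨ *-congˡ (trans (^-* ζ n (N / n)) (^-≡ ζ (ℕ.*-comm n (N / n)))) ⟩
    ζ ^ (N % n) * ζ ^ (N / n ℕ.* n)        ≈⟨ ^-+ ζ (N % n) (N / n ℕ.* n) ⟨
    ζ ^ (N % n ℕ.+ N / n ℕ.* n)            ≈⟨ ^-≡ ζ (m≡m%n+[m/n]*n N n) ⟨
    ζ ^ N                                  ≈⟨ ζᴺ≈1 ⟩
    1#                                     ∎))
    where open import Relation.Binary.Reasoning.Setoid setoid

  -- The order of ζ divides p^(e+1) - 1, so a common divisor of it and p divides two consecutive
  -- integers.
  periodic⇒rootOfUnity : ∀ {ζ} e → ζ ≉ 0# → ζ ^ (p ℕ.^ suc e) ≈ ζ → ¬ ¬ RootOfUnityCoprime ζ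
  -- From 1 < p^(e+1) comes N with 2 + N = p^(e+1), so `suc N` is the positive exponent p^(e+1) - 1.
  periodic⇒rootOfUnity {ζ} e ζ≉0 periodic h with ℕ.m≤n⇒∃[o]m+o≡n (ℕ.^-monoʳ-< p 1<p (s≤s (z≤n {e})))
  ... | N , eq = order-exists ζ (suc N) (s≤s z≤n) ζᴺ≈1 λ (n , ord@(0<n , ζⁿ≈1 , least)) →
        h (n , 0<n , ζⁿ≈1 , least , λ { {i} (i∣n , i∣p) → ∣1⇒≡1 (∣m+n∣m⇒∣n
          (≡.subst (i ∣_) (≡.trans (≡.sym eq) (≡.sym (ℕ.+-comm (suc N) 1))) (∣-trans i∣p (m∣m*n (p ℕ.^ e))))
          (∣-trans i∣n (order-∣ (suc N) ord ζᴺ≈1))) })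
    where
    ζᴺ≈1 : ζ ^ suc N ≈ 1#
    ζᴺ≈1 = *-cancelˡ ζ≉0 (trans (^-≡ ζ eq) (trans periodic (sym (*-identityʳ ζ))))

-- The three claims

module Main {c ℓ : Level} (K : ACField c ℓ) (q : ℕ) (1≤q : 1 ≤ q) (l : ℤ) (f : RatFun K)
            (summable : Mahler.MahlerSummable K (suc q) l f) where
  open ACField K
  open Mahler K (suc q)
  open Polynomials K
  open Field K
  open LocalFactors K
  open Spread K q using (p; σ)
  open Degrees K q
  open Expansions K q 1≤q
  open RootsOfUnity K q 1≤q hiding (p)

  g : RatFun K
  g = proj₁ summable

  positive : ∀ D → D ≢ just 0 → Positive D
  positive nothing        _ = tt
  positive (just zero)    h = ⊥-elim (h ≡.refl)
  positive (just (suc d)) _ = s≤s z≤n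

  fd≉0 : ¬ (RatFun.den f ≋ [])
  fd≉0 = NonZero⇒≉[] (RatFun.denNZ f)

  gd≉0 : ¬ (RatFun.den g ≋ [])
  gd≉0 = NonZero⇒≉[] (RatFun.denNZ g)

  module Tree {β : Carrier} (no-disp : ∀ d → 0 ℕ.< d → ¬ DispWitnessTree f β d) where
    open Poles K q f g (pPow l) using (pole⇒germ; module Germ)
    open Orbits K q f g (pPow l)

    -- Stated for an arbitrary pole of the tree, because claim (3) applies it to the pole that
    -- attains `ord`. For claim (2) the first component suffices, as n > 0.
    pole-in-tree : ∀ {δ n} → InTree β δ → PoleOfOrder f δ n →
                   ¬ ¬ (l ≡ + n × ∃ λ ζ → InTree β ζ × RootOfUnityCoprime ζ)
    pole-in-tree {δ} {n} δ∈tree pole h = cycle λ (ζ , e , ζ∈tree , periodic , eq) →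
      periodic⇒rootOfUnity e (proj₁ ζ∈tree) periodic λ root →
        h (exponent-unique l n e eq , ζ , ζ∈tree , root)
      where
      -- A pole comes with a finite multiplicity of the numerator, so f is not zero.
      fn≉0 = factor⇒≉[] (proj₁ δ∈tree) (Germ.numer (proj₁ (pole⇒germ pole)))
      open Propagation (pPow≉0 l) (mk≋ (proj₂ summable)) fn≉0 fd≉0 gd≉0
      open Dispersionless {β} no-disp δ∈tree pole

  coeff-beyond : ∀ P i → length P ≤ i → P [ i ] ≈ 0#
  coeff-beyond []      i       _        = refl
  coeff-beyond (a ∷ P) (suc i) (s≤s le) = coeff-beyond P i le

  -- Names the case distinction that `lcoeff` hides in a `with`, so that it can be rewritten along
  -- `n ⊖ i`.
  coeffℤ : Poly K → ℤ → Carrier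
  coeffℤ P (+ k)    = P [ k ]
  coeffℤ P -[1+ _ ] = 0#

  lcoeff-def : ∀ n P i → lcoeff (n , P) i ≡ coeffℤ P (i ℤ.+ + n)
  lcoeff-def n P i with i ℤ.+ + n
  ... | + k      = ≡.refl
  ... | -[1+ _ ] = ≡.refl

  coeffℤ-⊖ : ∀ P n i → coeffℤ P (n ℤ.⊖ i) ≡ backward P n i
  coeffℤ-⊖ P n       zero    = ≡.refl
  coeffℤ-⊖ P zero    (suc i) = ≡.refl
  coeffℤ-⊖ P (suc n) (suc i) = ≡.trans (≡.cong (coeffℤ P) (ℤ.[1+m]⊖[1+n]≡m⊖n n i)) (coeffℤ-⊖ P n i)

  lcoeff-negative : ∀ n P i → lcoeff (n , P) (ℤ.- (+ suc i)) ≡ backward P n (suc i)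
  lcoeff-negative n P i = ≡.trans (lcoeff-def n P (ℤ.- (+ suc i))) (coeffℤ-⊖ P n (suc i))

  module Infinity (n : ℕ) (A a b : Poly K) (b₀≉0 : b [ 0 ] ≉ 0#) {d : ℕ} (b-degree : Degree b d) (a-below : DegreeBelow a d)
                  (decomposition : (RatFun.num f ⊛ (xpow K n ⊛ b)) ≋ (A ⊛ b ⊕ a ⊛ xpow K n) ⊛ RatFun.den f) where

    L : Laurent
    L = n , A

    open Decomposition (RatFun.num f) (RatFun.den f) (RatFun.num g) (RatFun.den g) (pPow≉0 l)
                       (mk≋ (proj₂ summable)) fd≉0 n A a b decomposition

    -- Since σ fixes the constant term, the recursion at i = 0 reads c + φ = p^λ φ with the same φ
    -- on both sides; for λ = 0 this leaves c = 0.
    constant-term : l ≡ + 0 → ¬ ¬ (lcoeff L (+ 0) ≈ 0#)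
    constant-term ≡.refl h = at-∞ b-degree a-below gd≉0 λ (T , relation) → h (begin
      A [ n ]                     ≈⟨ reflexive (≡.cong (A [_]) (ℕ.+-identityʳ n)) ⟨
      A [ n ℕ.+ 0 ]               ≈⟨ +-cancelʳ (T [ 0 ]) _ _ (begin
        A [ n ℕ.+ 0 ] + T [ 0 ]     ≈⟨ relation 0 ⟩
        1# * σ T [ 0 ]              ≈⟨ *-identityˡ _ ⟩
        σ T [ 0 ]                   ≈⟨ coeff-σ-multiple T 0 ⟩
        T [ 0 ]                     ≈⟨ +-identityˡ _ ⟨
        0# + T [ 0 ]                ∎) ⟩
      0#                          ∎)
      where
      open ≈-Reasoning
      open import Algebra.Properties.Ring ring using (+-cancelʳ)

    module _ (no-disp : ∀ d → 0 ℕ.< d → ¬ DispWitnessInf L d) where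

      no-positive-coefficient : ∀ i → 0 ℕ.< i → lcoeff L (+ i) ≉ 0# → ⊥
      no-positive-coefficient i 0<i c≉0 = at-∞ b-degree a-below gd≉0 λ (T , relation) →
        Functional.dispersed (pPow≉0 l) {λ k → lcoeff L (+ k)} {T [_]} {σ T [_]}
          (λ k _ → trans (+-congʳ (reflexive (≡.cong (A [_]) (ℕ.+-comm k n)))) (relation k))
          (coeff-σ-multiple T) (coeff-σ-other T)
          (λ { (suc j) d _ 0<d x y → no-disp d 0<d (+ suc j , (λ ()) , x ,
                 ≡.subst (λ k → lcoeff L k ≉ 0#) (ℤ.pos-* (suc j) (p ℕ.^ d)) y) })
          (length T) (coeff-beyond T) i 0<i c≉0

      no-negative-coefficient : ∀ i → 0 ℕ.< i → lcoeff L (ℤ.- (+ i)) ≉ 0# → ⊥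
      no-negative-coefficient i 0<i c≉0 = at-0 b₀≉0 gd≉0 λ (T , m , relation) →
        Functional.dispersed (pPow≉0 l) {λ k → lcoeff L (ℤ.- (+ k))} {backward T m} {backward (σ T) (m ℕ.* p)}
          (λ { (suc k) 0<k → trans (+-congʳ (reflexive (lcoeff-negative n A k))) (relation (suc k) 0<k) })
          (backward-σ-multiple T m) (backward-σ-other T m)
          (λ { (suc j) d _ 0<d x y → no-disp d 0<d (ℤ.- (+ suc j) , (λ ()) , x ,
                 ≡.subst (λ k → lcoeff L k ≉ 0#)
                   (≡.trans (≡.cong ℤ.-_ (ℤ.pos-* (suc j) (p ℕ.^ d))) (ℤ.neg-distribˡ-* (+ suc j) (+ (p ℕ.^ d)))) y) })
          -- x^(-m) T has no power below x^(-m), so its support ends before `suc m`.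
          (suc m) (backward-beyond T m) i 0<i c≉0

      -- A witness for d = 0 amounts to one nonzero coefficient at some i ≠ 0, and both signs of i
      -- are excluded.
      constant-only : ¬ DispWitnessInf L 0
      constant-only (+ zero   , i≢0 , c≉0 , _) = i≢0 ≡.refl
      constant-only (+ suc i  , _   , c≉0 , _) = no-positive-coefficient (suc i) (s≤s z≤n) c≉0
      constant-only (-[1+ i ] , _   , c≉0 , _) = no-negative-coefficient (suc i) (s≤s z≤n) c≉0

    dispersion-positive : l ≡ + 0 ⊎ ¬ LConst L → ∀ D → DispInf L D → Positive D
    dispersion-positive (inj₁ l≡0)    D (inj₁ (_ , c₀≉0 , _))  = ⊥-elim (constant-term l≡0 c₀≉0)
    dispersion-positive (inj₂ ¬const) D (inj₁ (const , _ , _)) = ⊥-elim (¬const const)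
    dispersion-positive _             D (inj₂ (_ , disp))      =
      positive D λ { ≡.refl → constant-only (proj₂ disp) (proj₁ disp) }

  at-infinity : (L : Laurent) → IsInftyPart f L → LNonZero L → (l ≡ + 0 ⊎ ¬ LConst L) →
                (D : Maybe ℕ) → DispInf L D → Positive D
  at-infinity (n , A) (a , b , b₀≉0 , (d , b≉0 , b-below , a-below) , decomposition) _ =
    Infinity.dispersion-positive n A a b b₀≉0 (b≉0 , b-below) a-below (mk≋ decomposition)

  at-tree-nonpositive : l ≤ℤ + 0 → ∀ {β} → TreeInSupp f β → ∀ D → DispTree f β D → Positive D
  at-tree-nonpositive l≤0 {β} (δ , δ∈tree , n , pole) D disp = positive D λ where
    ≡.refl → Tree.pole-in-tree {β} (proj₂ disp) δ∈tree pole λ (l≡n , _) →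
      ℕ.<⇒≱ (proj₁ pole) (ℤ.drop‿+≤+ (≡.subst (_≤ℤ + 0) l≡n l≤0))

  at-tree : ∀ {β} → TreeInSupp f β → (InT0 β ⊎ ∃ (λ n → OrdIs f β n × + n ≢ l)) →
            ∀ D → DispTree f β D → Positive D
  at-tree {β} (δ , δ∈tree , k , pole) hyp D disp = positive D λ where
      ≡.refl → Tree.pole-in-tree {β} (proj₂ disp) δ∈tree pole λ (_ , ζ , ζ∈tree , root) →
        impossible hyp ζ∈tree root (proj₂ disp)
    where
    impossible : (InT0 β ⊎ ∃ (λ n → OrdIs f β n × + n ≢ l)) → ∀ {ζ} → InTree β ζ → RootOfUnityCoprime ζ →
                 (∀ d → 0 ℕ.< d → ¬ DispWitnessTree f β d) → ⊥
    impossible (inj₁ β∈T₀) ζ∈tree root _ = β∈T₀ _ ζ∈tree root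
    -- The value 0 of `ord` cannot occur here, as the pole at δ has order k with 0 < k ≤ n.
    impossible (inj₂ (n , (bound , inj₁ n≡0) , _)) _ _ _ =
      ℕ.<⇒≱ (proj₁ pole) (≡.subst (k ≤_) n≡0 (bound δ k δ∈tree pole))
    -- The pole that attains the maximum itself has order λ, so `ord` equals λ.
    impossible (inj₂ (n , (_ , inj₂ (α , α∈tree , poleα)) , n≢l)) _ _ no-disp =
      Tree.pole-in-tree {β} no-disp α∈tree poleα λ (l≡n , _) → n≢l (≡.sym l≡n)

theorem4p2 : ∀ {c ℓ : Level} (K : ACField c ℓ) (p : ℕ) → 2 ≤ p →
    let open ACField K in
    let open Mahler K p in
    (l : ℤ) (f : RatFun K) → MahlerSummable l f →
    ((L : Laurent) → IsInftyPart f L → LNonZero L →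
    (l ≡ + 0 ⊎ ¬ LConst L) →
    (D : Maybe ℕ) → DispInf L D → Positive D)
    × (l ≤ℤ + 0 → (β : ACField.Carrier K) → ¬ (β ≈ 0#) → TreeInSupp f β →
    (D : Maybe ℕ) → DispTree f β D → Positive D)
    × (+ 1 ≤ℤ l → (β : ACField.Carrier K) → ¬ (β ≈ 0#) → TreeInSupp f β →
    (InT0 β ⊎ ∃ (λ n → OrdIs f β n × + n ≢ l)) →
    (D : Maybe ℕ) → DispTree f β D → Positive D)
theorem4p2 K (suc q) (s≤s 1≤q) l f summable =
    at-infinity
  , (λ l≤0 β _ supp → at-tree-nonpositive l≤0 {β} supp)
  , (λ _ β _ supp hyp → at-tree {β} supp hyp)
  where open Main K q 1≤q l f summable
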